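{- Let $q$ be a prime power, $\mathbb{F}_q$ the field with $q$ elements, and let $e,d$ be integers with $e>d>0$. Let $g\in\mathbb{F}_q[T]$ be monic of degree $e$ with factorization pattern $(\lambda_1,\ldots,\lambda_e)$, and let $k$ be the least index with $\lambda_k>0$. Let $\lambda_k^*$ be the number of distinct monic irreducible factors of $g$ of degree $k$. Let $\mathcal{X}_g:\mathbb{F}_q[T]_d\to\{0,\ldots,d\}$, $\mathcal{X}_g(f)=\deg\gcd(g,f)$, where $\mathbb{F}_q[T]_d$ (the set of monic polynomials of degree $d$ in $\mathbb{F}_q[T]$) carries the uniform probability. If $k\le d$, then $$\frac{k\,\lambda_k^*}{q^k}-\binom{\lambda_k^*}{2}\frac{k}{q^{\min\{2k,d\}}}\le E[\mathcal{X}_g]\le \frac{k\,\lambda_k^*}{q^k}+\sum_{i=k+1}^d\frac{i}{q^i}\sum_{\substack{h_k\le\lambda_k,\ldots,\,h_i\le\lambda_i\\ k\,h_k+\cdots+i\,h_i=i}}\binom{\lambda_k}{h_k}\cdots\binom{\lambda_i}{h_i},$$ where the inner sum runs over tuples $(h_k,\ldots,h_i)$ of nonnegative integers.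
   Context: $g$ has factorization pattern $(\lambda_1,\ldots,\lambda_e)$ (with $\lambda_1+2\lambda_2+\cdots+e\lambda_e=e$) if $g$ has exactly $\lambda_i$ monic irreducible factors in $\mathbb{F}_q[T]$ of degree $i$, counted with multiplicity, for $1\le i\le e$. $E[\cdot]$ denotes expected value. -}

module Defs where

open import Level using (0ℓ)
open import Data.Nat as N using (ℕ; zero; suc; _≤_; _<_; _∸_; _^_)
open import Data.Nat.Combinatorics using (_C_)
open import Data.Nat.ListAction using (sum; product)
open import Data.Nat.Primality using (Prime)
open import Data.Fin using (Fin)
open import Data.Vec as Vec using (Vec; []; _∷_)
import Data.Vec.Properties as VecP
open import Data.List as List using (List; []; _∷_; _++_; map; concatMap; upTo; filter; length; zipWith; deduplicate; allFin)
open import Data.List.Relation.Unary.All using (All)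
open import Data.Product using (Σ; ∃; _×_; _,_; proj₁)
open import Data.Sum using (_⊎_)
open import Data.Integer using (+_)
open import Data.Rational using (ℚ; 0ℚ; _/_)
import Data.Rational
open import Relation.Binary.PropositionalEquality using (_≡_; refl)
open import Relation.Binary.Definitions using (DecidableEquality)
open import Relation.Nullary using (¬_; yes; no)
open import Algebra.Structures using (IsCommutativeRing)
open import Function.Bundles using (_↔_; Inverse)

IsPrimePower : ℕ → Set
IsPrimePower q = ∃ λ p → ∃ λ n → Prime p × (0 < n) × (q ≡ p ^ n)

record FiniteField (q : ℕ) : Set₁ where
  field
    Carrier : Set
    _+_ _*_ : Carrier → Carrier → Carrier
    -_      : Carrier → Carrier
    0# 1#   : Carrier
    isCommutativeRing : IsCommutativeRing _≡_ _+_ _*_ -_ 0# 1#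
    0≢1     : ¬ (0# ≡ 1#)
    inverse : ∀ x → ¬ (x ≡ 0#) → ∃ λ y → x * y ≡ 1#
    _≟_     : DecidableEquality Carrier
    enum    : Fin q ↔ Carrier

  elements : List Carrier
  elements = map (Inverse.to enum) (allFin q)

  -- Polynomials in F[T] as coefficient lists (constant term first);
  -- two lists denote the same polynomial iff all coefficients agree.

  Poly : Set
  Poly = List Carrier

  coeff : Poly → ℕ → Carrier
  coeff []       _       = 0#
  coeff (a ∷ as) zero    = a
  coeff (a ∷ as) (suc n) = coeff as n

  _≈ₚ_ : Poly → Poly → Set
  p ≈ₚ r = ∀ n → coeff p n ≡ coeff r n

  _+ₚ_ : Poly → Poly → Poly
  []       +ₚ r        = r
  (a ∷ as) +ₚ []       = a ∷ as
  (a ∷ as) +ₚ (b ∷ bs) = (a + b) ∷ (as +ₚ bs)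

  scale : Carrier → Poly → Poly
  scale c = map (c *_)

  _*ₚ_ : Poly → Poly → Poly
  []       *ₚ r = []
  (a ∷ as) *ₚ r = scale a r +ₚ (0# ∷ (as *ₚ r))

  _∣ₚ_ : Poly → Poly → Set
  p ∣ₚ r = ∃ λ s → (p *ₚ s) ≈ₚ r

  -- A monic polynomial of degree n is given by its n lower coefficients
  -- (a₀, …, a_{n-1}); it denotes a₀ + a₁T + … + a_{n-1}T^{n-1} + T^n.
  -- Thus Vec Carrier d is exactly F_q[T]_d.
  monic : ∀ {n} → Vec Carrier n → Poly
  monic v = Vec.toList v ++ (1# ∷ [])

  Irreducible : ∀ {n} → Vec Carrier n → Set
  Irreducible {n} g =
    (0 < n) × (∀ m (h : Vec Carrier m) → monic h ∣ₚ monic g → (m ≡ 0) ⊎ (m ≡ n))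

  -- m is the degree of gcd(g, f): the gcd is the monic common divisor
  -- of largest degree.
  IsDegGcd : ∀ {e d} → Vec Carrier e → Vec Carrier d → ℕ → Set
  IsDegGcd g f m =
    (∃ λ (h : Vec Carrier m) → (monic h ∣ₚ monic g) × (monic h ∣ₚ monic f))
    × (∀ m' (h : Vec Carrier m') → monic h ∣ₚ monic g → monic h ∣ₚ monic f → m' ≤ m)

  allMonic : (n : ℕ) → List (Vec Carrier n)
  allMonic zero    = [] ∷ []
  allMonic (suc n) = concatMap (λ v → map (_∷ v) elements) (allMonic n)

  Factor : Set
  Factor = Σ ℕ (Vec Carrier)

  prodFactors : List Factor → Poly
  prodFactors []             = 1# ∷ []
  prodFactors ((n , h) ∷ fs) = monic h *ₚ prodFactors fs

  IsFactorization : ∀ {e} → Vec Carrier e → List Factor → Set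
  IsFactorization g fs =
    All (λ x → Irreducible (Data.Product.proj₂ x)) fs × (prodFactors fs ≈ₚ monic g)

  ofDeg : (k : ℕ) → List Factor → List (Vec Carrier k)
  ofDeg k [] = []
  ofDeg k ((n , h) ∷ fs) with n N.≟ k
  ... | yes refl = h ∷ ofDeg k fs
  ... | no _     = ofDeg k fs

  pattern' : List Factor → ℕ → ℕ
  pattern' fs i = length (ofDeg i fs)

  distinctOfDeg : List Factor → ℕ → ℕ
  distinctOfDeg fs i = length (deduplicate (VecP.≡-dec _≟_) (ofDeg i fs))

-- a ÷ b as a rational number (only used with b ≠ 0; b = 0 gives 0)
_÷_ : ℕ → ℕ → ℚ
a ÷ zero  = 0ℚ
a ÷ suc b = (+ a) / suc b

-- [lo, lo+1, …, hi]  (empty if hi < lo)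
range : ℕ → ℕ → List ℕ
range lo hi = map (lo N.+_) (upTo (suc hi ∸ lo))

boxes : List ℕ → List (List ℕ)
boxes []       = [] ∷ []
boxes (b ∷ bs) = concatMap (λ h → map (h ∷_) (boxes bs)) (upTo (suc b))

innerSum : (ℕ → ℕ) → ℕ → ℕ → ℕ
innerSum λ' k i =
  sum (map (λ hs → product (zipWith _C_ bs hs))
           (filter (λ hs → sum (zipWith N._*_ js hs) N.≟ i) (boxes bs)))
  where
    js = range k i
    bs = map λ' js

sumℚ : List ℚ → ℚ
sumℚ = List.foldr Data.Rational._+_ 0ℚ

{-# OPTIONS --safe #-}

-- Write P₁, …, P_m for the distinct irreducible factors of g of degree k.
--
-- Lower bound: the Pⱼ that divide f are pairwise coprime, so their product divides
-- gcd(g, f), hence X(f) ≥ k #{j : Pⱼ | f}.  Exactly q^(d-k) monic f of degree d are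
-- divisible by a given Pⱼ, so already E[X] ≥ k m / q^k, and the subtracted term in the
-- theorem is nonnegative.
--
-- Upper bound: by unique factorization gcd(g, f) is the product of a sublist S of the
-- list of irreducible factors of g, and its degree is 0, or k (and S is one Pⱼ), or
-- some i with k < i ≤ d.  So X(f) is at most k #{j : Pⱼ | f} plus, for each such i, i
-- times the number of sublists S of total degree i whose product divides f.  Each such
-- product divides q^(d-i) polynomials f, and grouping the factors by degree shows that
-- the number of sublists of total degree i is the inner sum of binomials; this is
-- proved by adding one factor at a time, where Pascal's rule applies.

module Submission where

open import Defs
open import Level using (0ℓ)
open import Algebra.Bundles using (AbelianGroup; CommutativeMonoid; CommutativeRing)
import Algebra.Properties.CommutativeSemigroup as CommSemigroupProps
import Algebra.Properties.Ring as RingProps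
open import Algebra.Structures using (IsCommutativeRing)
open import Data.Empty using (⊥; ⊥-elim)
open import Data.Fin using (toℕ)
open import Data.List using (List; []; _∷_; _++_; map; concatMap; upTo; applyUpTo; filter; length; zipWith; deduplicate; allFin)
open import Data.List.Membership.Propositional using (_∈_; _∉_)
open import Data.List.Membership.Propositional.Properties using (∈-++⁺ˡ; ∈-++⁺ʳ; ∈-++⁻; ∈-map⁺; ∈-map⁻; ∈-allFin; ∈-upTo⁺; ∈-upTo⁻; ∈-concat⁺′; ∈-deduplicate⁺; ∈-deduplicate⁻)
open import Data.List.Properties using (length-map; length-tabulate; length-++; map-cong-local)
open import Data.List.Relation.Binary.Disjoint.Propositional using (Disjoint)
open import Data.List.Relation.Unary.All as All using (All; []; _∷_)
import Data.List.Relation.Unary.All.Properties as All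
import Data.List.Relation.Unary.AllPairs as AllPairs
import Data.List.Relation.Unary.AllPairs.Properties as AllPairs
open import Data.List.Relation.Unary.Any using (here; there)
open import Data.List.Relation.Unary.Unique.Propositional using (Unique; []; _∷_)
import Data.List.Relation.Unary.Unique.Propositional.Properties as Unique
import Data.List.Relation.Unary.Unique.DecPropositional.Properties as UniqueDec
open import Data.Nat as ℕ using (ℕ; zero; suc; s≤s; z≤n)
import Data.Nat.Properties as ℕₚ
open import Data.Nat.Induction using (<-wellFounded)
open import Data.Product using (∃; _×_; _,_; proj₁; proj₂)
open import Data.Sum using (_⊎_; inj₁; inj₂)
open import Data.Vec using (Vec; []; _∷_; tabulate)
import Data.Vec.Properties as Vec
open import Function using (_∘_; Inverse)
open import Induction.WellFounded using (Acc; acc)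
open import Relation.Binary.Bundles using (Setoid)
open import Relation.Binary.Definitions using (DecidableEquality; tri<; tri≈; tri>)
open import Relation.Binary.PropositionalEquality
import Relation.Binary.Reasoning.Setoid as SetoidReasoning
open import Relation.Nullary using (¬_; Dec; yes; no)
open import Relation.Unary using (Decidable)

-- The commutative ring of polynomials, with equality taken coefficientwise.

module PolynomialRing {q : ℕ} (F : FiniteField q) where

  open FiniteField F
  open IsCommutativeRing isCommutativeRing
    using (+-assoc; +-comm; +-identityˡ; +-identityʳ; -‿inverseʳ; *-assoc; *-comm; *-identityˡ; distribˡ; distribʳ; zeroˡ; zeroʳ)

  -- Wrapping _≈ₚ_ in a record lets Agda infer the two polynomials.
  infix 4 _≋_
  record _≋_ (p r : Poly) : Set where
    constructor mk≋
    field coeff≡ : p ≈ₚ r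
  open _≋_ public

  ≋-setoid : Setoid 0ℓ 0ℓ
  ≋-setoid = record
    { Carrier = Poly
    ; _≈_ = _≋_
    ; isEquivalence = record
      { refl  = mk≋ λ _ → refl
      ; sym   = λ e → mk≋ λ n → sym (coeff≡ e n)
      ; trans = λ e e' → mk≋ λ n → trans (coeff≡ e n) (coeff≡ e' n)
      }
    }

  open Setoid ≋-setoid public using () renaming (refl to ≋-refl; sym to ≋-sym; trans to ≋-trans)
  private module ≋R = SetoidReasoning ≋-setoid

  coeff-+ : ∀ p r n → coeff (p +ₚ r) n ≡ coeff p n + coeff r n
  coeff-+ []       r        n       = sym (+-identityˡ _)
  coeff-+ (a ∷ as) []       n       = sym (+-identityʳ _)
  coeff-+ (a ∷ as) (b ∷ bs) zero    = refl
  coeff-+ (a ∷ as) (b ∷ bs) (suc n) = coeff-+ as bs n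

  coeff-scale : ∀ c p n → coeff (scale c p) n ≡ c * coeff p n
  coeff-scale c []       n       = sym (zeroʳ c)
  coeff-scale c (a ∷ as) zero    = refl
  coeff-scale c (a ∷ as) (suc n) = coeff-scale c as n

  -0#≡0# : - 0# ≡ 0#
  -0#≡0# = trans (sym (+-identityˡ _)) (-‿inverseʳ 0#)

  -ₚ_ : Poly → Poly
  -ₚ_ = map (-_)

  coeff-neg : ∀ p n → coeff (-ₚ p) n ≡ - coeff p n
  coeff-neg []       n       = sym -0#≡0#
  coeff-neg (a ∷ as) zero    = refl
  coeff-neg (a ∷ as) (suc n) = coeff-neg as n

  ∷-cong : ∀ {a b p r} → a ≡ b → p ≋ r → a ∷ p ≋ b ∷ r
  ∷-cong a≡b p≋r = mk≋ λ { zero → a≡b ; (suc n) → coeff≡ p≋r n }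

  0∷[]≋[] : 0# ∷ [] ≋ []
  0∷[]≋[] = mk≋ λ { zero → refl ; (suc n) → refl }

  +ₚ-cong : ∀ {p p' r r'} → p ≋ p' → r ≋ r' → p +ₚ r ≋ p' +ₚ r'
  +ₚ-cong {p} {p'} {r} {r'} e f = mk≋ λ n →
    trans (coeff-+ p r n) (trans (cong₂ _+_ (coeff≡ e n) (coeff≡ f n)) (sym (coeff-+ p' r' n)))

  +ₚ-assoc : ∀ p r s → (p +ₚ r) +ₚ s ≋ p +ₚ (r +ₚ s)
  +ₚ-assoc p r s = mk≋ λ n → begin
    coeff ((p +ₚ r) +ₚ s) n             ≡⟨ coeff-+ (p +ₚ r) s n ⟩
    coeff (p +ₚ r) n + coeff s n        ≡⟨ cong (_+ _) (coeff-+ p r n) ⟩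
    (coeff p n + coeff r n) + coeff s n ≡⟨ +-assoc _ _ _ ⟩
    coeff p n + (coeff r n + coeff s n) ≡⟨ cong (_ +_) (coeff-+ r s n) ⟨
    coeff p n + coeff (r +ₚ s) n        ≡⟨ coeff-+ p (r +ₚ s) n ⟨
    coeff (p +ₚ (r +ₚ s)) n             ∎
    where open ≡-Reasoning

  +ₚ-comm : ∀ p r → p +ₚ r ≋ r +ₚ p
  +ₚ-comm p r = mk≋ λ n → trans (coeff-+ p r n) (trans (+-comm _ _) (sym (coeff-+ r p n)))

  +ₚ-identityʳ : ∀ p → p +ₚ [] ≋ p
  +ₚ-identityʳ p = +ₚ-comm p []

  -ₚ-inverseʳ : ∀ p → p +ₚ (-ₚ p) ≋ []
  -ₚ-inverseʳ p = mk≋ λ n → trans (coeff-+ p (-ₚ p) n) (trans (cong (coeff p n +_) (coeff-neg p n)) (-‿inverseʳ _))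

  -ₚ-cong : ∀ {p r} → p ≋ r → -ₚ p ≋ -ₚ r
  -ₚ-cong {p} {r} e = mk≋ λ n → trans (coeff-neg p n) (trans (cong -_ (coeff≡ e n)) (sym (coeff-neg r n)))

  +ₚ-abelianGroup : AbelianGroup 0ℓ 0ℓ
  +ₚ-abelianGroup = record
    { Carrier = Poly
    ; _≈_ = _≋_
    ; _∙_ = _+ₚ_
    ; ε = []
    ; _⁻¹ = -ₚ_
    ; isAbelianGroup = record
      { isGroup = record
        { isMonoid = record
          { isSemigroup = record
            { isMagma = record { isEquivalence = Setoid.isEquivalence ≋-setoid ; ∙-cong = +ₚ-cong }
            ; assoc = +ₚ-assoc
            }
          ; identity = (λ _ → ≋-refl) , +ₚ-identityʳ
          }
        ; inverse = (λ p → ≋-trans (+ₚ-comm (-ₚ p) p) (-ₚ-inverseʳ p)) , -ₚ-inverseʳ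
        ; ⁻¹-cong = -ₚ-cong
        }
      ; comm = +ₚ-comm
      }
    }

  private module AG = AbelianGroup +ₚ-abelianGroup
  open CommSemigroupProps (CommutativeMonoid.commutativeSemigroup AG.commutativeMonoid)
    using (interchange; x∙yz≈y∙xz)

  scale-cong : ∀ c {p r} → p ≋ r → scale c p ≋ scale c r
  scale-cong c {p} {r} e = mk≋ λ n →
    trans (coeff-scale c p n) (trans (cong (c *_) (coeff≡ e n)) (sym (coeff-scale c r n)))

  scale-+ₚ : ∀ c p r → scale c (p +ₚ r) ≋ scale c p +ₚ scale c r
  scale-+ₚ c p r = mk≋ λ n → begin
    coeff (scale c (p +ₚ r)) n                ≡⟨ coeff-scale c (p +ₚ r) n ⟩
    c * coeff (p +ₚ r) n                      ≡⟨ cong (c *_) (coeff-+ p r n) ⟩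
    c * (coeff p n + coeff r n)               ≡⟨ distribˡ c _ _ ⟩
    (c * coeff p n) + (c * coeff r n)         ≡⟨ cong₂ _+_ (coeff-scale c p n) (coeff-scale c r n) ⟨
    coeff (scale c p) n + coeff (scale c r) n ≡⟨ coeff-+ (scale c p) (scale c r) n ⟨
    coeff (scale c p +ₚ scale c r) n          ∎
    where open ≡-Reasoning

  scale-scale : ∀ a b p → scale (a * b) p ≋ scale a (scale b p)
  scale-scale a b p = mk≋ λ n → begin
    coeff (scale (a * b) p) n       ≡⟨ coeff-scale (a * b) p n ⟩
    (a * b) * coeff p n             ≡⟨ *-assoc a b _ ⟩
    a * (b * coeff p n)             ≡⟨ cong (a *_) (coeff-scale b p n) ⟨
    a * coeff (scale b p) n         ≡⟨ coeff-scale a (scale b p) n ⟨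
    coeff (scale a (scale b p)) n   ∎
    where open ≡-Reasoning

  scale-1# : ∀ p → scale 1# p ≋ p
  scale-1# p = mk≋ λ n → trans (coeff-scale 1# p n) (*-identityˡ _)

  scale-0# : ∀ p → scale 0# p ≋ []
  scale-0# p = mk≋ λ n → trans (coeff-scale 0# p n) (zeroˡ _)

  *ₚ-congˡ : ∀ p {r r'} → r ≋ r' → p *ₚ r ≋ p *ₚ r'
  *ₚ-congˡ []       e = ≋-refl
  *ₚ-congˡ (a ∷ as) e = +ₚ-cong (scale-cong a e) (∷-cong refl (*ₚ-congˡ as e))

  *ₚ-distribˡ : ∀ p r s → p *ₚ (r +ₚ s) ≋ (p *ₚ r) +ₚ (p *ₚ s)
  *ₚ-distribˡ []       r s = ≋-refl
  *ₚ-distribˡ (a ∷ as) r s = begin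
    scale a (r +ₚ s) +ₚ (0# ∷ (as *ₚ (r +ₚ s)))
      ≈⟨ +ₚ-cong (scale-+ₚ a r s) (∷-cong (sym (+-identityˡ 0#)) (*ₚ-distribˡ as r s)) ⟩
    (scale a r +ₚ scale a s) +ₚ ((0# ∷ (as *ₚ r)) +ₚ (0# ∷ (as *ₚ s)))
      ≈⟨ interchange (scale a r) (scale a s) (0# ∷ (as *ₚ r)) (0# ∷ (as *ₚ s)) ⟩
    (scale a r +ₚ (0# ∷ (as *ₚ r))) +ₚ (scale a s +ₚ (0# ∷ (as *ₚ s))) ∎
    where open ≋R

  *ₚ-zeroʳ : ∀ p → p *ₚ [] ≋ []
  *ₚ-zeroʳ []       = ≋-refl
  *ₚ-zeroʳ (a ∷ as) = ≋-trans (∷-cong refl (*ₚ-zeroʳ as)) 0∷[]≋[]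

  -- `_*ₚ_` recurses on its left factor. This is the mirrored recursion on the right factor, and
  -- commutativity follows from it by induction.
  *ₚ-∷ : ∀ p b bs → p *ₚ (b ∷ bs) ≋ scale b p +ₚ (0# ∷ (p *ₚ bs))
  *ₚ-∷ []       b bs = ≋-sym 0∷[]≋[]
  *ₚ-∷ (a ∷ as) b bs = ∷-cong (cong (_+ 0#) (*-comm a b)) (begin
    scale a bs +ₚ (as *ₚ (b ∷ bs))
      ≈⟨ +ₚ-cong (≋-refl {scale a bs}) (*ₚ-∷ as b bs) ⟩
    scale a bs +ₚ (scale b as +ₚ (0# ∷ (as *ₚ bs)))
      ≈⟨ x∙yz≈y∙xz (scale a bs) (scale b as) (0# ∷ (as *ₚ bs)) ⟩
    scale b as +ₚ (scale a bs +ₚ (0# ∷ (as *ₚ bs))) ∎)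
    where open ≋R

  *ₚ-comm : ∀ p r → p *ₚ r ≋ r *ₚ p
  *ₚ-comm []       r = ≋-sym (*ₚ-zeroʳ r)
  *ₚ-comm (a ∷ as) r = ≋-trans (+ₚ-cong (≋-refl {scale a r}) (∷-cong refl (*ₚ-comm as r))) (≋-sym (*ₚ-∷ r a as))

  -- Equal polynomials may be lists of different lengths, which makes an induction on the left
  -- factor awkward. Commutativity moves the change to the right factor instead.
  *ₚ-cong : ∀ {p p' r r'} → p ≋ p' → r ≋ r' → p *ₚ r ≋ p' *ₚ r'
  *ₚ-cong {p} {p'} {r} {r'} e f = begin
    p *ₚ r   ≈⟨ *ₚ-congˡ p f ⟩
    p *ₚ r'  ≈⟨ *ₚ-comm p r' ⟩
    r' *ₚ p  ≈⟨ *ₚ-congˡ r' e ⟩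
    r' *ₚ p' ≈⟨ *ₚ-comm r' p' ⟩
    p' *ₚ r' ∎
    where open ≋R

  *ₚ-distribʳ : ∀ s p r → (p +ₚ r) *ₚ s ≋ (p *ₚ s) +ₚ (r *ₚ s)
  *ₚ-distribʳ s p r = begin
    (p +ₚ r) *ₚ s          ≈⟨ *ₚ-comm (p +ₚ r) s ⟩
    s *ₚ (p +ₚ r)          ≈⟨ *ₚ-distribˡ s p r ⟩
    (s *ₚ p) +ₚ (s *ₚ r)   ≈⟨ +ₚ-cong (*ₚ-comm s p) (*ₚ-comm s r) ⟩
    (p *ₚ s) +ₚ (r *ₚ s)   ∎
    where open ≋R

  scale-*ₚ : ∀ c p r → scale c p *ₚ r ≋ scale c (p *ₚ r)
  scale-*ₚ c []       r = ≋-refl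
  scale-*ₚ c (a ∷ as) r = begin
    scale (c * a) r +ₚ (0# ∷ (scale c as *ₚ r))
      ≈⟨ +ₚ-cong (scale-scale c a r) (∷-cong (sym (zeroʳ c)) (scale-*ₚ c as r)) ⟩
    scale c (scale a r) +ₚ scale c (0# ∷ (as *ₚ r))
      ≈⟨ scale-+ₚ c (scale a r) (0# ∷ (as *ₚ r)) ⟨
    scale c (scale a r +ₚ (0# ∷ (as *ₚ r))) ∎
    where open ≋R

  *ₚ-assoc : ∀ p r s → (p *ₚ r) *ₚ s ≋ p *ₚ (r *ₚ s)
  *ₚ-assoc []       r s = ≋-refl
  *ₚ-assoc (a ∷ as) r s = begin
    (scale a r +ₚ (0# ∷ (as *ₚ r))) *ₚ s
      ≈⟨ *ₚ-distribʳ s (scale a r) (0# ∷ (as *ₚ r)) ⟩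
    (scale a r *ₚ s) +ₚ (scale 0# s +ₚ (0# ∷ ((as *ₚ r) *ₚ s)))
      ≈⟨ +ₚ-cong (scale-*ₚ a r s) (+ₚ-cong (scale-0# s) (∷-cong refl (*ₚ-assoc as r s))) ⟩
    scale a (r *ₚ s) +ₚ (0# ∷ (as *ₚ (r *ₚ s))) ∎
    where open ≋R

  *ₚ-identityˡ : ∀ p → (1# ∷ []) *ₚ p ≋ p
  *ₚ-identityˡ p = ≋-trans (+ₚ-cong (scale-1# p) 0∷[]≋[]) (+ₚ-identityʳ p)

  *ₚ-identityʳ : ∀ p → p *ₚ (1# ∷ []) ≋ p
  *ₚ-identityʳ p = ≋-trans (*ₚ-comm p (1# ∷ [])) (*ₚ-identityˡ p)

  polyRing : CommutativeRing 0ℓ 0ℓ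
  polyRing = record
    { Carrier = Poly
    ; _≈_ = _≋_
    ; _+_ = _+ₚ_
    ; _*_ = _*ₚ_
    ; -_ = -ₚ_
    ; 0# = []
    ; 1# = 1# ∷ []
    ; isCommutativeRing = record
      { isRing = record
        { +-isAbelianGroup = AG.isAbelianGroup
        ; *-cong = *ₚ-cong
        ; *-assoc = *ₚ-assoc
        ; *-identity = *ₚ-identityˡ , *ₚ-identityʳ
        ; distrib = *ₚ-distribˡ , *ₚ-distribʳ
        }
      ; *-comm = *ₚ-comm
      }
    }

-- Monic polynomials: degrees, products, quotients and cancellation.

module Divisibility {q : ℕ} (F : FiniteField q) where

  open FiniteField F
  open PolynomialRing F
  open IsCommutativeRing isCommutativeRing
    using (+-identityˡ; -‿inverseʳ; *-comm; *-identityʳ; zeroˡ; zeroʳ)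
  private
    module ≋R = SetoidReasoning ≋-setoid
    module CR = CommutativeRing polyRing
  open RingProps CR.ring using (-‿distribʳ-*)
  open CommSemigroupProps CR.*-commutativeSemigroup using (xy∙z≈xz∙y)
  open CommSemigroupProps CR.+-commutativeSemigroup using (interchange)

  -- A condition on coefficients rather than on the shape of the list, because computed products and
  -- quotients may carry trailing zeros.
  record IsMonic (n : ℕ) (p : Poly) : Set where
    constructor mkMonic
    field
      lead   : coeff p n ≡ 1#
      vanish : ∀ j → n ℕ.< j → coeff p j ≡ 0#
  open IsMonic

  IsMonic-resp-≋ : ∀ {n p r} → p ≋ r → IsMonic n p → IsMonic n r
  IsMonic-resp-≋ e (mkMonic l v) =
    mkMonic (trans (sym (coeff≡ e _)) l) (λ j n<j → trans (sym (coeff≡ e j)) (v j n<j))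

  monic-isMonic : ∀ {n} (v : Vec Carrier n) → IsMonic n (monic v)
  monic-isMonic []       = mkMonic refl λ { (suc j) _ → refl }
  monic-isMonic (a ∷ v)  with monic-isMonic v
  ... | mkMonic l w = mkMonic l λ { (suc j) (s≤s n<j) → w j n<j }

  -- Inverse to `monic` on monic polynomials of degree n. It gives a canonical representative, so
  -- that `_≋_` becomes propositional, decidable equality of vectors.
  toVec : ∀ n → Poly → Vec Carrier n
  toVec n p = tabulate (λ i → coeff p (toℕ i))

  coeff-monic-tabulate : ∀ n (c : ℕ → Carrier) → c n ≡ 1# → (∀ j → n ℕ.< j → c j ≡ 0#) →
    ∀ j → coeff (monic (tabulate {n = n} (λ i → c (toℕ i)))) j ≡ c j
  coeff-monic-tabulate zero    c l v zero    = sym l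
  coeff-monic-tabulate zero    c l v (suc j) = sym (v (suc j) (s≤s z≤n))
  coeff-monic-tabulate (suc n) c l v zero    = refl
  coeff-monic-tabulate (suc n) c l v (suc j) =
    coeff-monic-tabulate n (c ∘ suc) l (λ i n<i → v (suc i) (s≤s n<i)) j

  monic-toVec : ∀ {n p} → IsMonic n p → monic (toVec n p) ≋ p
  monic-toVec {n} {p} (mkMonic l v) = mk≋ (coeff-monic-tabulate n (coeff p) l v)

  toVec-cong : ∀ n {p r} → p ≋ r → toVec n p ≡ toVec n r
  toVec-cong n e = Vec.tabulate-cong (λ i → coeff≡ e (toℕ i))

  toVec-monic : ∀ {n} (v : Vec Carrier n) → toVec n (monic v) ≡ v
  toVec-monic []      = refl
  toVec-monic (a ∷ v) = cong (a ∷_) (toVec-monic v)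

  monic-injective : ∀ {n} {v w : Vec Carrier n} → monic v ≋ monic w → v ≡ w
  monic-injective {n} {v} {w} e = trans (sym (toVec-monic v)) (trans (toVec-cong n e) (toVec-monic w))

  IsMonic-0⇒≋1 : ∀ {p} → IsMonic 0 p → p ≋ 1# ∷ []
  IsMonic-0⇒≋1 (mkMonic l v) = mk≋ λ { zero → l ; (suc j) → v (suc j) (s≤s z≤n) }

  -- Write p = a + T p′ with p′ monic of degree one less. The part a r has degree at most n and does
  -- not reach the top coefficient of p r, which is therefore that of p′ r.
  IsMonic-* : ∀ {m n} p {r} → IsMonic m p → IsMonic n r → IsMonic (m ℕ.+ n) (p *ₚ r)
  IsMonic-* []       P R = ⊥-elim (0≢1 (lead P))
  IsMonic-* {zero}  (a ∷ as) {r} P R =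
    IsMonic-resp-≋ (≋-sym (≋-trans (*ₚ-cong (IsMonic-0⇒≋1 P) (≋-refl {r})) (*ₚ-identityˡ r))) R
  IsMonic-* {suc m} {n} (a ∷ as) {r} (mkMonic l v) R = mkMonic
    (trans (coeff-∷* (m ℕ.+ n)) (trans (cong₂ _+_ (high (m ℕ.+ n) ℕₚ.≤-refl) (lead IH)) (+-identityˡ _)))
    λ { (suc j) (s≤s m+n<j) →
        trans (coeff-∷* j) (trans (cong₂ _+_ (high j (ℕₚ.<⇒≤ m+n<j)) (vanish IH j m+n<j)) (+-identityˡ _)) }
    where
      IH : IsMonic (m ℕ.+ n) (as *ₚ r)
      IH = IsMonic-* as (mkMonic l λ j m<j → v (suc j) (s≤s m<j)) R
      coeff-∷* : ∀ j → coeff ((a ∷ as) *ₚ r) (suc j) ≡ (a * coeff r (suc j)) + coeff (as *ₚ r) j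
      coeff-∷* j = trans (coeff-+ (scale a r) (0# ∷ (as *ₚ r)) (suc j)) (cong (_+ _) (coeff-scale a r (suc j)))
      high : ∀ j → m ℕ.+ n ℕ.≤ j → a * coeff r (suc j) ≡ 0#
      high j le = trans (cong (a *_) (vanish R (suc j) (s≤s (ℕₚ.≤-trans (ℕₚ.m≤n+m n m) le)))) (zeroʳ a)

  -- A nonzero polynomial of degree below n, as a unit times a monic polynomial. The strict bound
  -- `deg<` is what makes Euclid's algorithm terminate.
  record ScaledMonic (n : ℕ) (p : Poly) : Set where
    constructor scaled
    field
      {deg}       : ℕ
      deg<        : deg ℕ.< n
      body        : Vec Carrier deg
      unit inv    : Carrier
      unit*inv    : unit * inv ≡ 1#
      p≋          : p ≋ scale unit (monic body)

  -- Searches downwards from n for the first nonzero coefficient and divides by it.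
  normalise : ∀ n p → (∀ j → n ℕ.≤ j → coeff p j ≡ 0#) → p ≋ [] ⊎ ScaledMonic n p
  normalise zero    p v = inj₁ (mk≋ λ j → v j z≤n)
  normalise (suc n) p v with coeff p n ≟ 0#
  ... | yes c≡0 with normalise n p v′
    where
      v′ : ∀ j → n ℕ.≤ j → coeff p j ≡ 0#
      v′ j n≤j with ℕₚ.m≤n⇒m<n∨m≡n n≤j
      ... | inj₁ n<j  = v j n<j
      ... | inj₂ refl = c≡0
  ...   | inj₁ p≋0 = inj₁ p≋0
  ...   | inj₂ (scaled lt w c b cb e) = inj₂ (scaled (ℕₚ.m≤n⇒m≤1+n lt) w c b cb e)
  normalise (suc n) p v | no c≢0 with inverse (coeff p n) c≢0
  ... | b , cb = inj₂ (scaled ℕₚ.≤-refl (toVec n (scale b p)) c b cb (≋-sym (begin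
      scale c (monic (toVec n (scale b p))) ≈⟨ scale-cong c (monic-toVec M) ⟩
      scale c (scale b p)                   ≈⟨ scale-scale c b p ⟨
      scale (c * b) p                       ≡⟨ cong (λ x → scale x p) cb ⟩
      scale 1# p                            ≈⟨ scale-1# p ⟩
      p                                     ∎)))
    where
      open ≋R
      c = coeff p n
      M : IsMonic n (scale b p)
      M = mkMonic (trans (coeff-scale b p n) (trans (*-comm b c) cb))
        (λ j n<j → trans (coeff-scale b p j) (trans (cong (b *_) (v j n<j)) (zeroʳ b)))

  coeff-beyond : ∀ p j → length p ℕ.≤ j → coeff p j ≡ 0#
  coeff-beyond []      j       _        = refl
  coeff-beyond (a ∷ p) (suc j) (s≤s le) = coeff-beyond p j le

  unit≢0 : ∀ {c b} → c * b ≡ 1# → ¬ (c ≡ 0#)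
  unit≢0 {c} {b} cb c≡0 = 0≢1 (trans (sym (zeroˡ b)) (trans (cong (_* b) (sym c≡0)) cb))

  -- If the degrees differed, the coefficient at the larger of the two would be both zero and
  -- nonzero. At equal degrees, comparing leading coefficients gives c = 1.
  scale-monic : ∀ {m n p c} → ¬ (c ≡ 0#) → IsMonic m p → IsMonic n (scale c p) → m ≡ n × c ≡ 1#
  scale-monic {m} {n} {p} {c} c≢0 P Q with ℕₚ.<-cmp m n
  ... | tri< m<n _ _ = ⊥-elim (0≢1 (begin
      0#                  ≡⟨ zeroʳ c ⟨
      c * 0#              ≡⟨ cong (c *_) (vanish P n m<n) ⟨
      c * coeff p n       ≡⟨ coeff-scale c p n ⟨
      coeff (scale c p) n ≡⟨ lead Q ⟩
      1#                  ∎))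
    where open ≡-Reasoning
  ... | tri> _ _ n<m = ⊥-elim (c≢0 (begin
      c                   ≡⟨ *-identityʳ c ⟨
      c * 1#              ≡⟨ cong (c *_) (lead P) ⟨
      c * coeff p m       ≡⟨ coeff-scale c p m ⟨
      coeff (scale c p) m ≡⟨ vanish Q m n<m ⟩
      0#                  ∎))
    where open ≡-Reasoning
  ... | tri≈ _ refl _ = refl , (begin
      c                   ≡⟨ *-identityʳ c ⟨
      c * 1#              ≡⟨ cong (c *_) (lead P) ⟨
      c * coeff p m       ≡⟨ coeff-scale c p m ⟨
      coeff (scale c p) m ≡⟨ lead Q ⟩
      1#                  ∎)
    where open ≡-Reasoning

  IsMonic-unique : ∀ {m n p} → IsMonic m p → IsMonic n p → m ≡ n
  IsMonic-unique {p = p} P Q =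
    proj₁ (scale-monic (λ e → 0≢1 (sym e)) P (IsMonic-resp-≋ (≋-sym (scale-1# p)) Q))

  *ₚ-scale : ∀ c p r → p *ₚ scale c r ≋ scale c (p *ₚ r)
  *ₚ-scale c p r = begin
    p *ₚ scale c r   ≈⟨ *ₚ-comm p (scale c r) ⟩
    scale c r *ₚ p   ≈⟨ scale-*ₚ c r p ⟩
    scale c (r *ₚ p) ≈⟨ scale-cong c (*ₚ-comm r p) ⟩
    scale c (p *ₚ r) ∎
    where open ≋R

  -- The cofactor s is nonzero since r is, so s = c w with c a unit and w monic. Then r = c (p w)
  -- with both r and p w monic, which forces c = 1 and makes the degrees add up.
  quotient-monic : ∀ {m n p s r} → IsMonic m p → IsMonic n r → p *ₚ s ≋ r →
    ∃ λ l → m ℕ.+ l ≡ n × IsMonic l s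
  quotient-monic {m} {n} {p} {s} {r} P R e with normalise (length s) s (coeff-beyond s)
  ... | inj₁ s≋0 = ⊥-elim (0≢1 (trans (sym (coeff≡ (*ₚ-zeroʳ p) n))
                     (lead (IsMonic-resp-≋ (≋-trans (≋-sym e) (*ₚ-congˡ p s≋0)) R))))
  ... | inj₂ (scaled {l} _ w c b cb s≋cw)
      with scale-monic (unit≢0 cb) (IsMonic-* p P (monic-isMonic w))
             (IsMonic-resp-≋ (≋-trans (≋-sym e) (≋-trans (*ₚ-congˡ p s≋cw) (*ₚ-scale c p (monic w)))) R)
  ...   | m+l≡n , refl = l , m+l≡n , IsMonic-resp-≋ (≋-sym (≋-trans s≋cw (scale-1# (monic w)))) (monic-isMonic w)

  -- If s = c w with w monic of degree l, then the coefficient of p s at m + l is the unit c, hence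
  -- not zero.
  monic-*≋0 : ∀ {m p s} → IsMonic m p → p *ₚ s ≋ [] → s ≋ []
  monic-*≋0 {m} {p} {s} P e with normalise (length s) s (coeff-beyond s)
  ... | inj₁ s≋0 = s≋0
  ... | inj₂ (scaled {l} _ w c b cb s≋cw) = ⊥-elim (unit≢0 cb (begin
      c                                           ≡⟨ *-identityʳ c ⟨
      c * 1#                                      ≡⟨ cong (c *_) (lead (IsMonic-* p P (monic-isMonic w))) ⟨
      c * coeff (p *ₚ monic w) (m ℕ.+ l)          ≡⟨ coeff-scale c (p *ₚ monic w) (m ℕ.+ l) ⟨
      coeff (scale c (p *ₚ monic w)) (m ℕ.+ l)    ≡⟨ coeff≡ (*ₚ-scale c p (monic w)) (m ℕ.+ l) ⟨
      coeff (p *ₚ scale c (monic w)) (m ℕ.+ l)    ≡⟨ coeff≡ (*ₚ-congˡ p s≋cw) (m ℕ.+ l) ⟨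
      coeff (p *ₚ s) (m ℕ.+ l)                    ≡⟨ coeff≡ e (m ℕ.+ l) ⟩
      0#                                          ∎))
    where open ≡-Reasoning

  *ₚ-neg : ∀ p r → p *ₚ (-ₚ r) ≋ -ₚ (p *ₚ r)
  *ₚ-neg p r = ≋-sym (-‿distribʳ-* p r)

  monic-cancelˡ : ∀ {m p s t} → IsMonic m p → p *ₚ s ≋ p *ₚ t → s ≋ t
  monic-cancelˡ {m} {p} {s} {t} P e = begin
    s                      ≈⟨ +ₚ-identityʳ s ⟨
    s +ₚ []                ≈⟨ +ₚ-cong (≋-refl {s}) (CR.-‿inverseˡ t) ⟨
    s +ₚ ((-ₚ t) +ₚ t)     ≈⟨ +ₚ-assoc s (-ₚ t) t ⟨
    (s +ₚ (-ₚ t)) +ₚ t     ≈⟨ +ₚ-cong (monic-*≋0 P diff) (≋-refl {t}) ⟩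
    t                      ∎
    where
      open ≋R
      diff : p *ₚ (s +ₚ (-ₚ t)) ≋ []
      diff = begin
        p *ₚ (s +ₚ (-ₚ t))               ≈⟨ *ₚ-distribˡ p s (-ₚ t) ⟩
        (p *ₚ s) +ₚ (p *ₚ (-ₚ t))        ≈⟨ +ₚ-cong e (*ₚ-neg p t) ⟩
        (p *ₚ t) +ₚ (-ₚ (p *ₚ t))        ≈⟨ -ₚ-inverseʳ (p *ₚ t) ⟩
        []                               ∎

  -- Divisibility, division with remainder and Euclid's algorithm.

  infix 4 _∣_
  record _∣_ (p r : Poly) : Set where
    constructor divides
    field
      quotient : Poly
      equality : p *ₚ quotient ≋ r

  ∣-refl : ∀ {p} → p ∣ p
  ∣-refl {p} = divides (1# ∷ []) (*ₚ-identityʳ p)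

  ∣-respʳ : ∀ {p r r'} → r ≋ r' → p ∣ r → p ∣ r'
  ∣-respʳ e (divides s ps≋r) = divides s (≋-trans ps≋r e)

  ∣-respˡ : ∀ {p p' r} → p ≋ p' → p ∣ r → p' ∣ r
  ∣-respˡ e (divides s ps≋r) = divides s (≋-trans (*ₚ-cong (≋-sym e) (≋-refl {s})) ps≋r)

  ∣-*ʳ : ∀ {x p} z → x ∣ p → x ∣ p *ₚ z
  ∣-*ʳ {x} {p} z (divides s e) = divides (s *ₚ z) (≋-trans (≋-sym (*ₚ-assoc x s z)) (*ₚ-cong e (≋-refl {z})))

  ∣-*ˡ : ∀ {x p} z → x ∣ p → x ∣ z *ₚ p
  ∣-*ˡ {x} {p} z d = ∣-respʳ (*ₚ-comm p z) (∣-*ʳ z d)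

  ∣-trans : ∀ {p r s} → p ∣ r → r ∣ s → p ∣ s
  ∣-trans d (divides t e) = ∣-respʳ e (∣-*ʳ t d)

  ∣-+ : ∀ {x a b} → x ∣ a → x ∣ b → x ∣ a +ₚ b
  ∣-+ {x} (divides s e) (divides t f) = divides (s +ₚ t) (≋-trans (*ₚ-distribˡ x s t) (+ₚ-cong e f))

  ∣-neg : ∀ {x a} → x ∣ a → x ∣ -ₚ a
  ∣-neg {x} (divides s e) = divides (-ₚ s) (≋-trans (*ₚ-neg x s) (-ₚ-cong e))

  ∣-cancelˡ : ∀ {x a b} → x ∣ a → x ∣ a +ₚ b → x ∣ b
  ∣-cancelˡ {x} {a} {b} d d' = ∣-respʳ (begin
    (-ₚ a) +ₚ (a +ₚ b)   ≈⟨ +ₚ-assoc (-ₚ a) a b ⟨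
    ((-ₚ a) +ₚ a) +ₚ b   ≈⟨ +ₚ-cong (CR.-‿inverseˡ a) (≋-refl {b}) ⟩
    b                    ∎) (∣-+ (∣-neg d) d')
    where open ≋R

  -- From as = h s + r one gets a + T as = h (T s) + (a + T r). The polynomial a + T r has degree at
  -- most n, and subtracting c h, with c its coefficient at n, brings the degree below n.
  divMod : ∀ {n h} → IsMonic n h → ∀ p →
    ∃ λ s → ∃ λ r → p ≋ (h *ₚ s) +ₚ r × (∀ j → n ℕ.≤ j → coeff r j ≡ 0#)
  divMod {n} {h} H []       = [] , [] , ≋-sym (≋-trans (+ₚ-identityʳ _) (*ₚ-zeroʳ h)) , λ _ _ → refl
  divMod {n} {h} H (a ∷ as) with divMod H as
  ... | s , r , as≋ , v = c ∷ s , r′ , eq , v′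
    where
      c = coeff (a ∷ r) n
      r′ = (a ∷ r) +ₚ (-ₚ (scale c h))
      eq : a ∷ as ≋ (h *ₚ (c ∷ s)) +ₚ r′
      eq = begin
        a ∷ as
          ≈⟨ ∷-cong (sym (+-identityˡ a)) as≋ ⟩
        A
          ≈⟨ +ₚ-identityʳ A ⟨
        A +ₚ []
          ≈⟨ +ₚ-cong (≋-refl {A}) (-ₚ-inverseʳ ch) ⟨
        ((0# ∷ (h *ₚ s)) +ₚ (a ∷ r)) +ₚ (ch +ₚ (-ₚ ch))
          ≈⟨ interchange (0# ∷ (h *ₚ s)) (a ∷ r) ch (-ₚ ch) ⟩
        ((0# ∷ (h *ₚ s)) +ₚ ch) +ₚ r′
          ≈⟨ +ₚ-cong (+ₚ-comm (0# ∷ (h *ₚ s)) ch) (≋-refl {r′}) ⟩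
        (ch +ₚ (0# ∷ (h *ₚ s))) +ₚ r′
          ≈⟨ +ₚ-cong (*ₚ-∷ h c s) (≋-refl {r′}) ⟨
        (h *ₚ (c ∷ s)) +ₚ r′ ∎
        where
          open ≋R
          ch = scale c h
          A = (0# ∷ (h *ₚ s)) +ₚ (a ∷ r)
      coeff-r′ : ∀ j → coeff r′ j ≡ coeff (a ∷ r) j + (- (c * coeff h j))
      coeff-r′ j = trans (coeff-+ (a ∷ r) (-ₚ (scale c h)) j)
        (cong (coeff (a ∷ r) j +_) (trans (coeff-neg (scale c h) j) (cong -_ (coeff-scale c h j))))
      above : ∀ j → n ℕ.< j → coeff (a ∷ r) j ≡ 0#
      above (suc j) (s≤s n≤j) = v j n≤j
      v′ : ∀ j → n ℕ.≤ j → coeff r′ j ≡ 0#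
      v′ j n≤j with ℕₚ.m≤n⇒m<n∨m≡n n≤j
      ... | inj₁ n<j = begin
        coeff r′ j                               ≡⟨ coeff-r′ j ⟩
        coeff (a ∷ r) j + (- (c * coeff h j))    ≡⟨ cong₂ (λ x y → x + (- (c * y))) (above j n<j) (vanish H j n<j) ⟩
        0# + (- (c * 0#))                        ≡⟨ cong (λ x → 0# + (- x)) (zeroʳ c) ⟩
        0# + (- 0#)                              ≡⟨ -‿inverseʳ 0# ⟩
        0#                                       ∎
        where open ≡-Reasoning
      ... | inj₂ refl = begin
        coeff r′ j                               ≡⟨ coeff-r′ j ⟩
        c + (- (c * coeff h j))                  ≡⟨ cong (λ y → c + (- (c * y))) (lead H) ⟩
        c + (- (c * 1#))                         ≡⟨ cong (λ x → c + (- x)) (*-identityʳ c) ⟩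
        c + (- c)                                ≡⟨ -‿inverseʳ c ⟩
        0#                                       ∎
        where open ≡-Reasoning

  -- The field bezout is what the identity gcd = u h + v p is used for; stated
  -- through divisibility it passes down Euclid's algorithm without tracking u and v.
  record Gcd (h p : Poly) : Set where
    field
      {deg}  : ℕ
      gcd    : Poly
      monicᵍ : IsMonic deg gcd
      ∣ˡ     : gcd ∣ h
      ∣ʳ     : gcd ∣ p
      bezout : ∀ x z → x ∣ h *ₚ z → x ∣ p *ₚ z → x ∣ gcd *ₚ z

  -- Induction on the degree of h. A nonzero remainder r of p modulo h is a unit times a monic w of
  -- smaller degree, and a gcd of w and h is also one of h and p.
  euclid : ∀ {n} → Acc ℕ._<_ n → ∀ {h} → IsMonic n h → ∀ p → Gcd h p
  euclid (acc rec) {h} H p with divMod H p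
  ... | s , r , p≋ , v with normalise _ r v
  ...   | inj₁ r≋0 = record
    { gcd = h ; monicᵍ = H ; ∣ˡ = ∣-refl ; bezout = λ x z d _ → d
    ; ∣ʳ = divides s (≋-sym (≋-trans p≋ (≋-trans (+ₚ-cong (≋-refl {h *ₚ s}) r≋0) (+ₚ-identityʳ _)))) }
  ...   | inj₂ (scaled lt w c b cb r≋cw) = record
    -- The recursive call has w in the first place and h in the second, so its `∣ʳ` is divisibility
    -- of h.
    { gcd = gcd ; monicᵍ = monicᵍ ; ∣ˡ = ∣ʳ
    ; ∣ʳ = ∣-respʳ (≋-sym p≋) (∣-+ (∣-*ʳ s ∣ʳ) (∣-trans ∣ˡ w∣r))
    ; bezout = λ x z x∣hz x∣pz → bezout x z (x∣wz x∣hz x∣pz) x∣hz }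
    where
      open Gcd (euclid (rec lt) (monic-isMonic w) h)
      w∣r : monic w ∣ r
      w∣r = divides (scale c (1# ∷ [])) (begin
        monic w *ₚ scale c (1# ∷ []) ≈⟨ *ₚ-scale c (monic w) (1# ∷ []) ⟩
        scale c (monic w *ₚ (1# ∷ [])) ≈⟨ scale-cong c (*ₚ-identityʳ (monic w)) ⟩
        scale c (monic w)            ≈⟨ r≋cw ⟨
        r                            ∎)
        where open ≋R
      r∣w : r ∣ monic w
      r∣w = divides (scale b (1# ∷ [])) (begin
        r *ₚ scale b (1# ∷ [])     ≈⟨ *ₚ-scale b r (1# ∷ []) ⟩
        scale b (r *ₚ (1# ∷ []))   ≈⟨ scale-cong b (*ₚ-identityʳ r) ⟩
        scale b r                  ≈⟨ scale-cong b r≋cw ⟩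
        scale b (scale c (monic w)) ≈⟨ scale-scale b c (monic w) ⟨
        scale (b * c) (monic w)    ≡⟨ cong (λ x → scale x (monic w)) (trans (*-comm b c) cb) ⟩
        scale 1# (monic w)         ≈⟨ scale-1# (monic w) ⟩
        monic w                    ∎)
        where open ≋R
      x∣wz : ∀ {x z} → x ∣ h *ₚ z → x ∣ p *ₚ z → x ∣ monic w *ₚ z
      x∣wz {x} {z} x∣hz x∣pz = ∣-respʳ rzt≋wz (∣-*ʳ t x∣rz)
        where
          t = _∣_.quotient r∣w
          -- Since p z = h s z + r z and x divides both p z and h z, it divides r z.
          x∣rz : x ∣ r *ₚ z
          x∣rz = ∣-cancelˡ (∣-respʳ (xy∙z≈xz∙y h z s) (∣-*ʳ s x∣hz))
            (∣-respʳ (≋-trans (*ₚ-cong p≋ (≋-refl {z})) (*ₚ-distribʳ z (h *ₚ s) r)) x∣pz)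
          rzt≋wz : (r *ₚ z) *ₚ t ≋ monic w *ₚ z
          rzt≋wz = ≋-trans (xy∙z≈xz∙y r z t) (*ₚ-cong (_∣_.equality r∣w) (≋-refl {z}))

  -- The gcd of P and h has degree 0 or n: it is 1, and `bezout` gives the second alternative, or it
  -- is P, and P divides h. The free test divisor x covers both uses of coprimality: x = h gives
  -- that h ∣ P z implies h ∣ z, and x = P gives that P ∣ h z implies P ∣ z.
  irreducible-coprime : ∀ {n} (P : Vec Carrier n) → Irreducible P → ∀ h →
    monic P ∣ h ⊎ (∀ x z → x ∣ monic P *ₚ z → x ∣ h *ₚ z → x ∣ z)
  irreducible-coprime {n} P (_ , irr) h =
    decide (irr deg (toVec deg gcd) (let divides s e = ∣-respˡ (≋-sym (monic-toVec monicᵍ)) ∣ˡ in s , coeff≡ e))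
    where
      open Gcd (euclid (<-wellFounded n) (monic-isMonic P) h)
      decide : (deg ≡ 0) ⊎ (deg ≡ n) → _
      decide (inj₁ deg≡0) = inj₂ λ x z x∣Pz x∣hz →
        ∣-respʳ (≋-trans (*ₚ-cong (IsMonic-0⇒≋1 (subst (λ l → IsMonic l gcd) deg≡0 monicᵍ)) (≋-refl {z})) (*ₚ-identityˡ z))
          (bezout x z x∣Pz x∣hz)
      decide (inj₂ deg≡n) with ∣ˡ
      ... | divides s gs≋P with quotient-monic monicᵍ (monic-isMonic P) gs≋P
      ...   | l , deg+l≡n , S = inj₁ (∣-respˡ gcd≋P ∣ʳ)
        where
          l≡0 : l ≡ 0
          l≡0 = ℕₚ.+-cancelˡ-≡ deg l 0 (trans deg+l≡n (trans (sym deg≡n) (sym (ℕₚ.+-identityʳ deg))))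
          gcd≋P : gcd ≋ monic P
          gcd≋P = ≋-trans (≋-sym (≋-trans (*ₚ-congˡ gcd (IsMonic-0⇒≋1 (subst (λ i → IsMonic i s) l≡0 S))) (*ₚ-identityʳ gcd))) gs≋P

  -- Divisors of a product of irreducible polynomials.

  degreeSum : List Factor → ℕ
  degreeSum []             = 0
  degreeSum ((n , _) ∷ fs) = n ℕ.+ degreeSum fs

  prodFactors-isMonic : ∀ fs → IsMonic (degreeSum fs) (prodFactors fs)
  prodFactors-isMonic []             = mkMonic refl λ { (suc j) _ → refl }
  prodFactors-isMonic ((n , h) ∷ fs) = IsMonic-* (monic h) (monic-isMonic h) (prodFactors-isMonic fs)

  -- Sublists are taken by position: a sublist occurs once for every way of choosing it among
  -- repeated factors, which is how the binomials of the upper bound count.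
  subs : List Factor → List (List Factor)
  subs []       = [] ∷ []
  subs (x ∷ xs) = subs xs ++ map (x ∷_) (subs xs)

  subs-All : ∀ {P : Factor → Set} fs → All P fs → ∀ {S} → S ∈ subs fs → All P S
  subs-All []       _        (here refl) = []
  subs-All (x ∷ fs) (px ∷ ps) S∈ with ∈-++⁻ (subs fs) S∈
  ... | inj₁ S∈′ = subs-All fs ps S∈′
  ... | inj₂ S∈′ with ∈-map⁻ (x ∷_) S∈′
  ...   | S′ , S′∈ , refl = px ∷ subs-All fs ps S′∈

  AllIrreducible : List Factor → Set
  AllIrreducible = All (λ x → Irreducible (proj₂ x))

  -- Induction on the factors. If h is coprime to the first factor P, it divides the product of the
  -- others. Otherwise h = P t, and cancelling P shows that t divides that product.
  divisor-is-subproduct : ∀ fs → AllIrreducible fs → ∀ {n h} → IsMonic n h → h ∣ prodFactors fs →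
    ∃ λ S → S ∈ subs fs × h ≋ prodFactors S
  divisor-is-subproduct [] _ {n} {h} H (divides s e)
    with quotient-monic H (prodFactors-isMonic []) e
  ... | l , n+l≡0 , _ = [] , here refl ,
    IsMonic-0⇒≋1 (subst (λ i → IsMonic i h) (ℕₚ.m+n≡0⇒m≡0 n n+l≡0) H)
  divisor-is-subproduct ((m , P) ∷ fs) (irrP ∷ irr) {n} {h} H (divides s e) with irreducible-coprime P irrP h
  ... | inj₂ coprime =
    let S , S∈ , h≋S = divisor-is-subproduct fs irr H (coprime h (prodFactors fs) (divides s e) (∣-*ʳ (prodFactors fs) ∣-refl))
    in S , ∈-++⁺ˡ S∈ , h≋S
  ... | inj₁ (divides t Pt≋h) =
    let _ , _ , T = quotient-monic (monic-isMonic P) H Pt≋h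
        ts≋Q = monic-cancelˡ (monic-isMonic P) (begin
          monic P *ₚ (t *ₚ s)  ≈⟨ *ₚ-assoc (monic P) t s ⟨
          (monic P *ₚ t) *ₚ s  ≈⟨ *ₚ-cong Pt≋h (≋-refl {s}) ⟩
          h *ₚ s               ≈⟨ e ⟩
          monic P *ₚ prodFactors fs ∎)
        S , S∈ , t≋S = divisor-is-subproduct fs irr T (divides s ts≋Q)
    in (m , P) ∷ S , ∈-++⁺ʳ (subs fs) (∈-map⁺ ((m , P) ∷_) S∈) ,
       ≋-trans (≋-sym Pt≋h) (*ₚ-congˡ (monic P) t≋S)
    where open ≋R

  monic-∣⇒≡ : ∀ {k} {P Q : Vec Carrier k} → monic P ∣ monic Q → P ≡ Q
  monic-∣⇒≡ {k} {P} {Q} (divides s e) with quotient-monic (monic-isMonic P) (monic-isMonic Q) e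
  ... | l , k+l≡k , S = monic-injective (≋-trans (≋-sym (≋-trans
    (*ₚ-congˡ (monic P) (IsMonic-0⇒≋1 (subst (λ i → IsMonic i s) (ℕₚ.+-cancelˡ-≡ k l 0 (trans k+l≡k (sym (ℕₚ.+-identityʳ k)))) S)))
    (*ₚ-identityʳ (monic P)))) e)

  -- Write f = P f′. Any other Q in the list has the same degree as P and differs from it, so Q does
  -- not divide P and must divide f′. The induction then applies to f′.
  distinct-irreducibles-∣ : ∀ {k} (Ps : List (Vec Carrier k)) → Unique Ps → All Irreducible Ps →
    ∀ {f} → All (λ P → monic P ∣ f) Ps → prodFactors (map (k ,_) Ps) ∣ f
  distinct-irreducibles-∣ []       _          _            {f} _ = divides f (*ₚ-identityˡ f)
  distinct-irreducibles-∣ {k} (P ∷ Ps) (P∉ ∷ uniq) (irrP ∷ irr) {f} (divides f′ Pf′≋f ∷ ds) =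
    let divides s e = distinct-irreducibles-∣ Ps uniq irr (All.zipWith remaining (All.zip (P∉ , irr) , ds))
    in divides s (≋-trans (*ₚ-assoc (monic P) (prodFactors (map (k ,_) Ps)) s) (≋-trans (*ₚ-congˡ (monic P) e) Pf′≋f))
    where
      remaining : ∀ {Q} → (¬ (P ≡ Q) × Irreducible Q) × monic Q ∣ f → monic Q ∣ f′
      remaining {Q} ((P≢Q , irrQ) , Q∣f) with irreducible-coprime Q irrQ (monic P)
      ... | inj₁ Q∣P = ⊥-elim (P≢Q (sym (monic-∣⇒≡ Q∣P)))
      ... | inj₂ coprime = coprime (monic Q) f′ (∣-*ʳ f′ ∣-refl) (∣-respʳ (≋-sym Pf′≋f) Q∣f)

open import Data.Nat using (2+; NonZero; _+_; _*_; _^_; _∸_; _⊓_; _≤_; _<_; _≤?_; s≤s⁻¹)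
open import Data.Nat.Combinatorics using (_C_; nCk+nC[k+1]≡[n+1]C[k+1])
open import Data.Nat.Combinatorics.Specification using (k>n⇒nCk≡0)
open import Data.Nat.ListAction using (sum; product)
open import Data.Nat.Properties hiding (_≟_)
open import Data.Nat.Tactic.RingSolver using () renaming (solve-∀ to solve-∀ℕ)

-- Finite sums of natural numbers and indicator functions.

private variable
  A B : Set

∑ : List A → (A → ℕ) → ℕ
∑ xs φ = sum (map φ xs)

∑-cong-∈ : ∀ (xs : List A) {φ ψ : A → ℕ} → (∀ {x} → x ∈ xs → φ x ≡ ψ x) → ∑ xs φ ≡ ∑ xs ψ
∑-cong-∈ []       e = refl
∑-cong-∈ (x ∷ xs) e = cong₂ _+_ (e (here refl)) (∑-cong-∈ xs (e ∘ there))

∑-cong : ∀ (xs : List A) {φ ψ : A → ℕ} → (∀ x → φ x ≡ ψ x) → ∑ xs φ ≡ ∑ xs ψ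
∑-cong xs e = ∑-cong-∈ xs (λ {x} _ → e x)

∑-mono : ∀ (xs : List A) {φ ψ : A → ℕ} → (∀ x → φ x ≤ ψ x) → ∑ xs φ ≤ ∑ xs ψ
∑-mono []       e = z≤n
∑-mono (x ∷ xs) e = +-mono-≤ (e x) (∑-mono xs e)

∑-∈ : ∀ {xs : List A} (φ : A → ℕ) {x} → x ∈ xs → φ x ≤ ∑ xs φ
∑-∈ φ (here refl) = m≤m+n _ _
∑-∈ φ (there x∈)  = ≤-trans (∑-∈ φ x∈) (m≤n+m _ _)

∑-+ : ∀ (xs : List A) (φ ψ : A → ℕ) → ∑ xs (λ x → φ x + ψ x) ≡ ∑ xs φ + ∑ xs ψ
∑-+ []       φ ψ = refl
∑-+ (x ∷ xs) φ ψ = trans (cong (φ x + ψ x +_) (∑-+ xs φ ψ)) (lemma (φ x) (ψ x) (∑ xs φ) (∑ xs ψ))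
  where
    lemma : ∀ a b c d → a + b + (c + d) ≡ a + c + (b + d)
    lemma = solve-∀ℕ

∑-const : ∀ (xs : List A) c → ∑ xs (λ _ → c) ≡ length xs * c
∑-const []       c = refl
∑-const (x ∷ xs) c = cong (c +_) (∑-const xs c)

∑-zero : ∀ (xs : List A) → ∑ xs (λ _ → 0) ≡ 0
∑-zero xs = trans (∑-const xs 0) (*-zeroʳ (length xs))

∑-*ˡ : ∀ (xs : List A) c (φ : A → ℕ) → ∑ xs (λ x → c * φ x) ≡ c * ∑ xs φ
∑-*ˡ []       c φ = sym (*-zeroʳ c)
∑-*ˡ (x ∷ xs) c φ = trans (cong (c * φ x +_) (∑-*ˡ xs c φ)) (sym (*-distribˡ-+ c (φ x) (∑ xs φ)))

∑-*ʳ : ∀ (xs : List A) (φ : A → ℕ) c → ∑ xs (λ x → φ x * c) ≡ ∑ xs φ * c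
∑-*ʳ xs φ c = trans (∑-cong xs (λ x → *-comm (φ x) c)) (trans (∑-*ˡ xs c φ) (*-comm c (∑ xs φ)))

∑-swap : ∀ (xs : List A) (ys : List B) (φ : A → B → ℕ) →
  ∑ xs (λ x → ∑ ys (φ x)) ≡ ∑ ys (λ y → ∑ xs (λ x → φ x y))
∑-swap []       ys φ = sym (∑-zero ys)
∑-swap (x ∷ xs) ys φ = trans (cong (∑ ys (φ x) +_) (∑-swap xs ys φ)) (sym (∑-+ ys (φ x) _))

∑-++ : ∀ (xs ys : List A) (φ : A → ℕ) → ∑ (xs ++ ys) φ ≡ ∑ xs φ + ∑ ys φ
∑-++ []       ys φ = refl
∑-++ (x ∷ xs) ys φ = trans (cong (φ x +_) (∑-++ xs ys φ)) (sym (+-assoc (φ x) _ _))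

∑-map : ∀ (f : A → B) (xs : List A) (φ : B → ℕ) → ∑ (map f xs) φ ≡ ∑ xs (φ ∘ f)
∑-map f []       φ = refl
∑-map f (x ∷ xs) φ = cong (φ (f x) +_) (∑-map f xs φ)

∑-concatMap : ∀ (f : A → List B) (xs : List A) (φ : B → ℕ) →
  ∑ (concatMap f xs) φ ≡ ∑ xs (λ x → ∑ (f x) φ)
∑-concatMap f []       φ = refl
∑-concatMap f (x ∷ xs) φ = trans (∑-++ (f x) (concatMap f xs) φ) (cong (∑ (f x) φ +_) (∑-concatMap f xs φ))

𝟙 : ∀ {P : Set} → Dec P → ℕ
𝟙 (yes _) = 1
𝟙 (no _)  = 0

𝟙-true : ∀ {P : Set} (D : Dec P) → P → 𝟙 D ≡ 1
𝟙-true (yes _) p = refl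
𝟙-true (no ¬p) p = ⊥-elim (¬p p)

𝟙-false : ∀ {P : Set} (D : Dec P) → ¬ P → 𝟙 D ≡ 0
𝟙-false (yes p) ¬p = ⊥-elim (¬p p)
𝟙-false (no _)  _  = refl

∑-filter : ∀ {P : A → Set} (P? : Decidable P) (xs : List A) (φ : A → ℕ) →
  ∑ (filter P? xs) φ ≡ ∑ xs (λ x → φ x * 𝟙 (P? x))
∑-filter P? []       φ = refl
∑-filter P? (x ∷ xs) φ with P? x
... | yes _ = cong₂ _+_ (sym (*-identityʳ (φ x))) (∑-filter P? xs φ)
... | no _  = trans (∑-filter P? xs φ) (cong (_+ ∑ xs (λ y → φ y * 𝟙 (P? y))) (sym (*-zeroʳ (φ x))))

length-filter≡∑ : ∀ {P : A → Set} (P? : Decidable P) (xs : List A) →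
  length (filter P? xs) ≡ ∑ xs (λ x → 𝟙 (P? x))
length-filter≡∑ P? xs = begin
  length (filter P? xs)           ≡⟨ *-identityʳ _ ⟨
  length (filter P? xs) * 1       ≡⟨ ∑-const (filter P? xs) 1 ⟨
  ∑ (filter P? xs) (λ _ → 1)      ≡⟨ ∑-filter P? xs (λ _ → 1) ⟩
  ∑ xs (λ x → 1 * 𝟙 (P? x))       ≡⟨ ∑-cong xs (λ x → *-identityˡ _) ⟩
  ∑ xs (λ x → 𝟙 (P? x))           ∎
  where open ≡-Reasoning

module _ {P : A → Set} (P? : Decidable P) where

  ∑𝟙-positive : ∀ xs → 0 < ∑ xs (λ x → 𝟙 (P? x)) → ∃ λ x → P x
  ∑𝟙-positive (x ∷ xs) pos with P? x
  ... | yes px = x , px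
  ... | no _   = ∑𝟙-positive xs pos

  ∑𝟙≥1 : ∀ {xs x} → x ∈ xs → P x → 1 ≤ ∑ xs (λ x → 𝟙 (P? x))
  ∑𝟙≥1 {x = x} x∈ px = subst (_≤ _) (𝟙-true (P? x) px) (∑-∈ (λ x → 𝟙 (P? x)) x∈)

  ∑𝟙≤1 : (∀ {x y} → P x → P y → x ≡ y) → ∀ {xs} → Unique xs → ∑ xs (λ x → 𝟙 (P? x)) ≤ 1
  ∑𝟙≤1 P-unique [] = z≤n
  ∑𝟙≤1 P-unique {x ∷ xs} (x∉ ∷ uniq) with P? x
  ... | no _   = ∑𝟙≤1 P-unique uniq
  ... | yes px = ≤-reflexive (cong suc (trans
    (∑-cong-∈ xs (λ {y} y∈ → 𝟙-false (P? y) (λ py → All.lookup x∉ y∈ (P-unique px py)))) (∑-zero xs)))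

-- Pascal's rule and sums of products of binomials.

∑-applyUpTo : ∀ (f : ℕ → A) n (φ : A → ℕ) → ∑ (applyUpTo f n) φ ≡ sum (applyUpTo (φ ∘ f) n)
∑-applyUpTo f zero    φ = refl
∑-applyUpTo f (suc n) φ = cong (φ (f 0) +_) (∑-applyUpTo (f ∘ suc) n φ)

∑-upTo-suc : ∀ n φ → ∑ (upTo (suc n)) φ ≡ φ 0 + ∑ (upTo n) (φ ∘ suc)
∑-upTo-suc n φ = cong (φ 0 +_) (trans (∑-applyUpTo suc n φ) (sym (∑-applyUpTo (λ x → x) n (φ ∘ suc))))

∑-upTo-last : ∀ n φ → ∑ (upTo (suc n)) φ ≡ ∑ (upTo n) φ + φ n
∑-upTo-last zero    φ = +-comm (φ 0) 0
∑-upTo-last (suc n) φ = begin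
  ∑ (upTo (2+ n)) φ                              ≡⟨ ∑-upTo-suc (suc n) φ ⟩
  φ 0 + ∑ (upTo (suc n)) (φ ∘ suc)               ≡⟨ cong (φ 0 +_) (∑-upTo-last n (φ ∘ suc)) ⟩
  φ 0 + (∑ (upTo n) (φ ∘ suc) + φ (suc n))       ≡⟨ +-assoc (φ 0) _ _ ⟨
  φ 0 + ∑ (upTo n) (φ ∘ suc) + φ (suc n)         ≡⟨ cong (_+ φ (suc n)) (∑-upTo-suc n φ) ⟨
  ∑ (upTo (suc n)) φ + φ (suc n)                 ∎
  where open ≡-Reasoning

-- A choice among b + 1 items either omits the new item, leaving h chosen among the others, or takes
-- it, which turns h into h + 1.
∑-pascal : ∀ b (ψ : ℕ → ℕ) →
  ∑ (upTo (2+ b)) (λ h → (suc b C h) * ψ h) ≡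
  ∑ (upTo (suc b)) (λ h → (b C h) * ψ h) + ∑ (upTo (suc b)) (λ h → (b C h) * ψ (suc h))
∑-pascal b ψ = begin
  ∑ (upTo (2+ b)) (λ h → (suc b C h) * ψ h)
    ≡⟨ ∑-upTo-suc (suc b) (λ h → (suc b C h) * ψ h) ⟩
  (b C 0) * ψ 0 + ∑ (upTo (suc b)) (λ h → (suc b C suc h) * ψ (suc h))
    ≡⟨ cong ((b C 0) * ψ 0 +_) (∑-cong (upTo (suc b)) split) ⟩
  (b C 0) * ψ 0 + ∑ (upTo (suc b)) (λ h → (b C suc h) * ψ (suc h) + (b C h) * ψ (suc h))
    ≡⟨ cong ((b C 0) * ψ 0 +_) (∑-+ (upTo (suc b)) (λ h → (b C suc h) * ψ (suc h)) _) ⟩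
  (b C 0) * ψ 0 + (∑ (upTo (suc b)) (λ h → (b C suc h) * ψ (suc h)) + R)
    ≡⟨ +-assoc ((b C 0) * ψ 0) _ R ⟨
  (b C 0) * ψ 0 + ∑ (upTo (suc b)) (λ h → (b C suc h) * ψ (suc h)) + R
    ≡⟨ cong (_+ R) (∑-upTo-suc (suc b) (λ h → (b C h) * ψ h)) ⟨
  ∑ (upTo (2+ b)) (λ h → (b C h) * ψ h) + R
    -- The recombined sum runs one index too far; its last binomial, `b C suc b`, is zero.
    ≡⟨ cong (_+ R) (∑-upTo-last (suc b) (λ h → (b C h) * ψ h)) ⟩
  ∑ (upTo (suc b)) (λ h → (b C h) * ψ h) + (b C suc b) * ψ (suc b) + R
    ≡⟨ cong (λ c → ∑ (upTo (suc b)) (λ h → (b C h) * ψ h) + c * ψ (suc b) + R) (k>n⇒nCk≡0 (n<1+n b)) ⟩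
  ∑ (upTo (suc b)) (λ h → (b C h) * ψ h) + 0 + R
    ≡⟨ cong (_+ R) (+-identityʳ (∑ (upTo (suc b)) (λ h → (b C h) * ψ h))) ⟩
  ∑ (upTo (suc b)) (λ h → (b C h) * ψ h) + R ∎
  where
    open ≡-Reasoning
    R = ∑ (upTo (suc b)) (λ h → (b C h) * ψ (suc h))
    split : ∀ h → (suc b C suc h) * ψ (suc h) ≡ (b C suc h) * ψ (suc h) + (b C h) * ψ (suc h)
    split h = trans (cong (_* ψ (suc h)) (trans (sym (nCk+nC[k+1]≡[n+1]C[k+1] b h)) (+-comm (b C h) _)))
      (*-distribʳ-+ (ψ (suc h)) (b C suc h) (b C h))

-- The inner sum of the theorem, with the condition "weight = i" replaced by an
-- arbitrary test function of the weight.
boxSum : List ℕ → List ℕ → (ℕ → ℕ) → ℕ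
boxSum js bs φ = ∑ (boxes bs) (λ hs → product (zipWith _C_ bs hs) * φ (sum (zipWith _*_ js hs)))

boxSum-cong : ∀ js bs {φ ψ : ℕ → ℕ} → (∀ x → φ x ≡ ψ x) → boxSum js bs φ ≡ boxSum js bs ψ
boxSum-cong js bs e = ∑-cong (boxes bs) (λ hs → cong (product (zipWith _C_ bs hs) *_) (e _))

-- The weight j h of the first entry is absorbed into the test function, so a statement proved for
-- all φ can be used inductively on the remaining entries.
boxSum-∷ : ∀ j js b bs φ →
  boxSum (j ∷ js) (b ∷ bs) φ ≡ ∑ (upTo (suc b)) (λ h → (b C h) * boxSum js bs (λ x → φ (j * h + x)))
boxSum-∷ j js b bs φ = trans (∑-concatMap (λ h → map (h ∷_) (boxes bs)) (upTo (suc b)) _)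
  (∑-cong (upTo (suc b)) λ h → trans (∑-map (h ∷_) (boxes bs) _)
    (trans (∑-cong (boxes bs) (λ hs → *-assoc (b C h) (product (zipWith _C_ bs hs)) _)) (∑-*ˡ (boxes bs) (b C h) _)))

-- One more available factor of degree n: by Pascal's rule at the entry n, it is either left out, or
-- taken, adding n to the weight. Uniqueness of `js` ensures that a single entry changes. This
-- matches the recursion of `subs`.
boxSum-increment : ∀ {μ ν : ℕ → ℕ} {n} → ν n ≡ suc (μ n) → (∀ j → j ≢ n → ν j ≡ μ j) →
  ∀ {js} → Unique js → n ∈ js → ∀ φ →
  boxSum js (map ν js) φ ≡ boxSum js (map μ js) φ + boxSum js (map μ js) (λ x → φ (n + x))
boxSum-increment {μ} {ν} {n} νn ν≡μ {.n ∷ js} (n∉ ∷ uniq) (here refl) φ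
  rewrite νn | map-cong-local (All.map (λ n≢j → ν≡μ _ (n≢j ∘ sym)) n∉) = begin
  boxSum (n ∷ js) (suc (μ n) ∷ bs) φ
    ≡⟨ boxSum-∷ n js (suc (μ n)) bs φ ⟩
  ∑ (upTo (2+ (μ n))) (λ h → (suc (μ n) C h) * ψ h)
    ≡⟨ ∑-pascal (μ n) ψ ⟩
  ∑ (upTo (suc (μ n))) (λ h → (μ n C h) * ψ h) + ∑ (upTo (suc (μ n))) (λ h → (μ n C h) * ψ (suc h))
    ≡⟨ cong₂ _+_ (sym (boxSum-∷ n js (μ n) bs φ))
        (trans (∑-cong (upTo (suc (μ n))) λ h → cong ((μ n C h) *_) (boxSum-cong js bs (λ x → cong φ (shift h x))))
          (sym (boxSum-∷ n js (μ n) bs (λ x → φ (n + x))))) ⟩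
  boxSum (n ∷ js) (μ n ∷ bs) φ + boxSum (n ∷ js) (μ n ∷ bs) (λ x → φ (n + x)) ∎
  where
    open ≡-Reasoning
    bs = map μ js
    ψ = λ h → boxSum js bs (λ x → φ (n * h + x))
    shift : ∀ h x → n * suc h + x ≡ n + (n * h + x)
    shift h x = trans (cong (_+ x) (*-suc n h)) (+-assoc n (n * h) x)
boxSum-increment {μ} {ν} {n} νn ν≡μ {j ∷ js} (j∉ ∷ uniq) (there n∈) φ
  rewrite ν≡μ j (All.lookup j∉ n∈) = begin
  boxSum (j ∷ js) (μ j ∷ map ν js) φ
    ≡⟨ boxSum-∷ j js (μ j) (map ν js) φ ⟩
  ∑ hs (λ h → (μ j C h) * boxSum js (map ν js) (λ x → φ (j * h + x)))
    ≡⟨ ∑-cong hs (λ h → trans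
        (cong ((μ j C h) *_) (trans (boxSum-increment νn ν≡μ uniq n∈ (λ x → φ (j * h + x)))
          (cong (boxSum js bs (λ x → φ (j * h + x)) +_) (boxSum-cong js bs (λ x → cong φ (swap (j * h) n x))))))
        (*-distribˡ-+ (μ j C h) _ _)) ⟩
  ∑ hs (λ h → (μ j C h) * boxSum js bs (λ x → φ (j * h + x)) + (μ j C h) * boxSum js bs (λ x → φ (n + (j * h + x))))
    ≡⟨ ∑-+ hs (λ h → (μ j C h) * boxSum js bs (λ x → φ (j * h + x))) _ ⟩
  ∑ hs (λ h → (μ j C h) * boxSum js bs (λ x → φ (j * h + x))) + ∑ hs (λ h → (μ j C h) * boxSum js bs (λ x → φ (n + (j * h + x))))
    ≡⟨ cong₂ _+_ (boxSum-∷ j js (μ j) bs φ) (boxSum-∷ j js (μ j) bs (λ x → φ (n + x))) ⟨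
  boxSum (j ∷ js) (μ j ∷ bs) φ + boxSum (j ∷ js) (μ j ∷ bs) (λ x → φ (n + x)) ∎
  where
    open ≡-Reasoning
    hs = upTo (suc (μ j))
    bs = map μ js
    swap : ∀ a b c → a + (b + c) ≡ b + (a + c)
    swap = solve-∀ℕ

-- The only tuple in the box is the zero tuple, with coefficient 1 and weight 0.
boxSum-[] : ∀ js φ → φ 0 ≡ boxSum js (map (λ _ → 0) js) φ
boxSum-[] []       φ = sym (trans (+-identityʳ _) (+-identityʳ _))
boxSum-[] (j ∷ js) φ = begin
  φ 0                                                ≡⟨ cong φ (trans (+-identityʳ (j * 0)) (*-zeroʳ j)) ⟨
  φ (j * 0 + 0)                                      ≡⟨ boxSum-[] js (λ x → φ (j * 0 + x)) ⟩
  boxSum js (map (λ _ → 0) js) (λ x → φ (j * 0 + x)) ≡⟨ trans (+-identityʳ _) (+-identityʳ _) ⟨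
  _                                                  ≡⟨ boxSum-∷ j js 0 (map (λ _ → 0) js) φ ⟨
  boxSum (j ∷ js) (0 ∷ map (λ _ → 0) js) φ           ∎
  where open ≡-Reasoning

innerSum≡boxSum : ∀ μ k i → innerSum μ k i ≡ boxSum (range k i) (map μ (range k i)) (λ x → 𝟙 (x ℕ.≟ i))
innerSum≡boxSum μ k i = ∑-filter (λ hs → sum (zipWith _*_ (range k i) hs) ℕ.≟ i) (boxes (map μ (range k i))) _

∈-range⁺ : ∀ {lo hi n} → lo ≤ n → n ≤ hi → n ∈ range lo hi
∈-range⁺ {lo} {hi} {n} lo≤n n≤hi = subst (_∈ range lo hi) (m+[n∸m]≡n lo≤n)
  (∈-map⁺ (lo +_) (∈-upTo⁺ (subst (n ∸ lo <_) (sym (+-∸-assoc 1 (≤-trans lo≤n n≤hi))) (s≤s (∸-monoˡ-≤ lo n≤hi)))))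

∈-range⇒≤ : ∀ {lo hi n} → n ∈ range lo hi → n ≤ hi
∈-range⇒≤ {lo} {hi} n∈ with ∈-map⁻ (lo +_) n∈
... | t , t∈ , refl = s≤s⁻¹ (subst (_≤ suc hi) (cong suc (+-comm t lo)) (m≤o∸n⇒m+n≤o (suc t) lo≤ t<))
  where
    t< : t < suc hi ∸ lo
    t< = ∈-upTo⁻ t∈
    -- An index below the truncated difference shows that it is positive, hence a true difference.
    lo≤ : lo ≤ suc hi
    lo≤ = <⇒≤ (m∸n≢0⇒n<m (m<n⇒n≢0 t<))

range-unique : ∀ lo hi → Unique (range lo hi)
range-unique lo hi = Unique.map⁺ (+-cancelˡ-≡ lo _ _) (Unique.upTo⁺ (suc hi ∸ lo))

-- Counting monic polynomials and monic multiples of a given polynomial.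

module Counting {q : ℕ} (F : FiniteField q) where

  open FiniteField F hiding (_+_; _*_)
  open PolynomialRing F
  open Divisibility F

  _≟ᵛ_ : ∀ {n} → DecidableEquality (Vec Carrier n)
  _≟ᵛ_ = Vec.≡-dec _≟_

  ∈-elements : ∀ x → x ∈ elements
  ∈-elements x = subst (_∈ elements) (Inverse.strictlyInverseˡ enum x)
    (∈-map⁺ (Inverse.to enum) (∈-allFin (Inverse.from enum x)))

  elements-unique : Unique elements
  elements-unique = Unique.map⁺ (λ {x} {y} e → trans (sym (Inverse.strictlyInverseʳ enum x))
    (trans (cong (Inverse.from enum) e) (Inverse.strictlyInverseʳ enum y))) (Unique.allFin⁺ q)

  length-elements : length elements ≡ q
  length-elements = trans (length-map (Inverse.to enum) (allFin q)) (length-tabulate (λ i → i))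

  ∈-allMonic : ∀ {n} (v : Vec Carrier n) → v ∈ allMonic n
  ∈-allMonic []      = here refl
  ∈-allMonic (x ∷ v) = ∈-concat⁺′ (∈-map⁺ (_∷ v) (∈-elements x)) (∈-map⁺ (λ w → map (_∷ w) elements) (∈-allMonic v))

  allMonic-unique : ∀ n → Unique (allMonic n)
  allMonic-unique zero    = [] ∷ []
  allMonic-unique (suc n) = Unique.concat⁺
    (All.map⁺ (All.universal (λ v → Unique.map⁺ Vec.∷-injectiveˡ elements-unique) (allMonic n)))
    (AllPairs.map⁺ (AllPairs.map disjoint (allMonic-unique n)))
    where
      disjoint : ∀ {v w} → v ≢ w → Disjoint (map (_∷ v) elements) (map (_∷ w) elements)
      disjoint {v} {w} v≢w (u∈ , u∈′) with ∈-map⁻ (_∷ v) u∈ | ∈-map⁻ (_∷ w) u∈′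
      ... | x , _ , refl | y , _ , e = v≢w (Vec.∷-injectiveʳ e)

  length-allMonic : ∀ n → length (allMonic n) ≡ q ^ n
  length-allMonic zero    = refl
  length-allMonic (suc n) = begin
    length (allMonic (suc n))                        ≡⟨ go (allMonic n) ⟩
    length (allMonic n) * q                          ≡⟨ cong (_* q) (length-allMonic n) ⟩
    q ^ n * q                                        ≡⟨ *-comm (q ^ n) q ⟩
    q * q ^ n                                        ∎
    where
      open ≡-Reasoning
      go : ∀ vs → length (concatMap (λ v → map (_∷ v) elements) vs) ≡ length vs * q
      go []       = refl
      go (v ∷ vs) = trans (length-++ (map (_∷ v) elements))
        (cong₂ _+_ (trans (length-map (_∷ v) elements) length-elements) (go vs))

  -- For p monic of degree i ≤ d this is 1 if p divides f and 0 otherwise.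
  multiples : ∀ {d} → ℕ → Poly → Vec Carrier d → ℕ
  multiples {d} i p f = ∑ (allMonic (d ∸ i)) (λ s → 𝟙 (toVec d (p *ₚ monic s) ≟ᵛ f))

  -- Double counting: each cofactor s contributes to exactly one f, namely `toVec d (p *ₚ monic s)`,
  -- so the total is the number of cofactors.
  ∑-multiples : ∀ d i p → ∑ (allMonic d) (multiples i p) ≡ q ^ (d ∸ i)
  ∑-multiples d i p = begin
    ∑ (allMonic d) (multiples i p)
      ≡⟨ ∑-swap (allMonic d) (allMonic (d ∸ i)) _ ⟩
    ∑ (allMonic (d ∸ i)) (λ s → ∑ (allMonic d) (λ f → 𝟙 (toVec d (p *ₚ monic s) ≟ᵛ f)))
      ≡⟨ ∑-cong (allMonic (d ∸ i)) (λ s → ≤-antisym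
          (∑𝟙≤1 (toVec d (p *ₚ monic s) ≟ᵛ_) (λ e e' → trans (sym e) e') (allMonic-unique d))
          (∑𝟙≥1 (toVec d (p *ₚ monic s) ≟ᵛ_) (∈-allMonic _) refl)) ⟩
    ∑ (allMonic (d ∸ i)) (λ _ → 1)
      ≡⟨ ∑-const (allMonic (d ∸ i)) 1 ⟩
    length (allMonic (d ∸ i)) * 1
      ≡⟨ *-identityʳ _ ⟩
    length (allMonic (d ∸ i))
      ≡⟨ length-allMonic (d ∸ i) ⟩
    q ^ (d ∸ i) ∎
    where open ≡-Reasoning

  module _ {d i : ℕ} {p : Poly} (p-monic : IsMonic i p) (f : Vec Carrier d) where

    ∣⇒multiples≥1 : p ∣ monic f → 1 ≤ multiples i p f
    ∣⇒multiples≥1 (divides s e) with quotient-monic p-monic (monic-isMonic f) e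
    -- Here d has become i + l, and the rewrite turns d ∸ i into l, the degree of the cofactor.
    ... | l , refl , s-monic rewrite m+n∸m≡n i l =
      ∑𝟙≥1 (λ t → toVec d (p *ₚ monic t) ≟ᵛ f) (∈-allMonic (toVec l s))
        (trans (toVec-cong d (≋-trans (*ₚ-congˡ p (monic-toVec s-monic)) e)) (toVec-monic f))

    module _ (i≤d : i ≤ d) where

      *-monic : (s : Vec Carrier (d ∸ i)) → IsMonic d (p *ₚ monic s)
      *-monic s = subst (λ n → IsMonic n (p *ₚ monic s)) (m+[n∸m]≡n i≤d) (IsMonic-* p p-monic (monic-isMonic s))

      *-monic≋ : ∀ {s : Vec Carrier (d ∸ i)} → toVec d (p *ₚ monic s) ≡ f → p *ₚ monic s ≋ monic f
      *-monic≋ {s} refl = ≋-sym (monic-toVec (*-monic s))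

      -- The cofactor of p in f is unique, because the monic p can be cancelled.
      multiples≤1 : multiples i p f ≤ 1
      multiples≤1 = ∑𝟙≤1 (λ s → toVec d (p *ₚ monic s) ≟ᵛ f)
        (λ e e' → monic-injective (monic-cancelˡ p-monic (≋-trans (*-monic≋ e) (≋-sym (*-monic≋ e')))))
        (allMonic-unique (d ∸ i))

      multiples>0⇒∣ : 0 < multiples i p f → p ∣ monic f
      multiples>0⇒∣ pos with ∑𝟙-positive (λ s → toVec d (p *ₚ monic s) ≟ᵛ f) (allMonic (d ∸ i)) pos
      ... | s , e = divides (monic s) (*-monic≋ e)

  -- Factors sorted by degree, and sublists of given total degree.

  ∈-ofDeg⁺ : ∀ {n h} fs → (n , h) ∈ fs → h ∈ ofDeg n fs
  ∈-ofDeg⁺ {n} ((m , h) ∷ fs) x∈ with m ℕ.≟ n | x∈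
  ... | yes refl | here refl = here refl
  ... | yes refl | there x∈′ = there (∈-ofDeg⁺ fs x∈′)
  ... | no m≢n   | here refl = ⊥-elim (m≢n refl)
  ... | no _     | there x∈′ = ∈-ofDeg⁺ fs x∈′

  ∈-ofDeg⁻ : ∀ {n h} fs → h ∈ ofDeg n fs → (n , h) ∈ fs
  ∈-ofDeg⁻ {n} ((m , h) ∷ fs) x∈ with m ℕ.≟ n | x∈
  ... | yes refl | here refl = here refl
  ... | yes refl | there x∈′ = there (∈-ofDeg⁻ fs x∈′)
  ... | no _     | x∈′       = there (∈-ofDeg⁻ fs x∈′)

  pattern-≡ : ∀ n h fs → pattern' ((n , h) ∷ fs) n ≡ suc (pattern' fs n)
  pattern-≡ n h fs with n ℕ.≟ n
  ... | yes refl = refl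
  ... | no n≢n   = ⊥-elim (n≢n refl)

  pattern-≢ : ∀ n h fs j → j ≢ n → pattern' ((n , h) ∷ fs) j ≡ pattern' fs j
  pattern-≢ n h fs j j≢n with n ℕ.≟ j
  ... | yes refl = ⊥-elim (j≢n refl)
  ... | no _     = refl

  -- Induction on the factors; the sublists split into those without and those with the new factor,
  -- of degree n. If n is in `js`, `boxSum-increment` splits the right side in the same way. If not,
  -- φ vanishes from n on, so the sublists with the new factor contribute nothing, and the
  -- multiplicities over `js` stay the same.
  ∑-subs≤boxSum : ∀ {js} → Unique js → ∀ fs (φ : ℕ → ℕ) →
    All (λ x → proj₁ x ∈ js ⊎ (proj₁ x ∉ js × (∀ y → proj₁ x ≤ y → φ y ≡ 0))) fs →
    ∑ (subs fs) (φ ∘ degreeSum) ≤ boxSum js (map (pattern' fs) js) φ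
  ∑-subs≤boxSum {js} uniq [] φ _ = ≤-reflexive (trans (+-identityʳ (φ 0)) (boxSum-[] js φ))
  ∑-subs≤boxSum {js} uniq ((n , h) ∷ fs) φ (cond ∷ conds) = begin
    ∑ (subs ((n , h) ∷ fs)) (φ ∘ degreeSum)
      ≡⟨ trans (∑-++ (subs fs) _ _) (cong (∑ (subs fs) (φ ∘ degreeSum) +_) (∑-map ((n , h) ∷_) (subs fs) _)) ⟩
    ∑ (subs fs) (φ ∘ degreeSum) + ∑ (subs fs) (φₙ ∘ degreeSum)
      ≤⟨ step cond ⟩
    boxSum js (map (pattern' ((n , h) ∷ fs)) js) φ ∎
    where
      open ≤-Reasoning
      φₙ = λ x → φ (n + x)
      shifted : ∀ {x : Factor} → proj₁ x ∈ js ⊎ (proj₁ x ∉ js × (∀ y → proj₁ x ≤ y → φ y ≡ 0)) →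
                proj₁ x ∈ js ⊎ (proj₁ x ∉ js × (∀ y → proj₁ x ≤ y → φₙ y ≡ 0))
      shifted (inj₁ m∈)       = inj₁ m∈
      shifted (inj₂ (m∉ , z)) = inj₂ (m∉ , λ y m≤y → z (n + y) (≤-trans m≤y (m≤n+m y n)))
      step : n ∈ js ⊎ (n ∉ js × (∀ y → n ≤ y → φ y ≡ 0)) →
             ∑ (subs fs) (φ ∘ degreeSum) + ∑ (subs fs) (φₙ ∘ degreeSum) ≤ boxSum js (map (pattern' ((n , h) ∷ fs)) js) φ
      step (inj₁ n∈) = begin
        ∑ (subs fs) (φ ∘ degreeSum) + ∑ (subs fs) (φₙ ∘ degreeSum)
          ≤⟨ +-mono-≤ (∑-subs≤boxSum uniq fs φ conds) (∑-subs≤boxSum uniq fs φₙ (All.map (λ {x} → shifted {x}) conds)) ⟩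
        boxSum js (map (pattern' fs) js) φ + boxSum js (map (pattern' fs) js) φₙ
          ≡⟨ boxSum-increment (pattern-≡ n h fs) (pattern-≢ n h fs) uniq n∈ φ ⟨
        boxSum js (map (pattern' ((n , h) ∷ fs)) js) φ ∎
      step (inj₂ (n∉ , z)) = begin
        ∑ (subs fs) (φ ∘ degreeSum) + ∑ (subs fs) (φₙ ∘ degreeSum)
          ≡⟨ cong (∑ (subs fs) (φ ∘ degreeSum) +_) (trans (∑-cong (subs fs) (λ S → z (n + degreeSum S) (m≤m+n n _))) (∑-zero (subs fs))) ⟩
        ∑ (subs fs) (φ ∘ degreeSum) + 0
          ≡⟨ +-identityʳ _ ⟩
        ∑ (subs fs) (φ ∘ degreeSum)
          ≤⟨ ∑-subs≤boxSum uniq fs φ conds ⟩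
        boxSum js (map (pattern' fs) js) φ
          ≡⟨ cong (λ bs → boxSum js bs φ) (map-cong-local (All.tabulate (λ {j} j∈ → pattern-≢ n h fs j (λ { refl → n∉ j∈ })))) ⟨
        boxSum js (map (pattern' ((n , h) ∷ fs)) js) φ ∎

  -- The test function is the indicator of i. A factor of degree above i lies outside `range k i`,
  -- but it cannot occur in a sublist of total degree i either.
  ∑-subs≤innerSum : ∀ fs k i → All (λ x → k ≤ proj₁ x) fs →
    ∑ (subs fs) (λ S → 𝟙 (degreeSum S ℕ.≟ i)) ≤ innerSum (pattern' fs) k i
  ∑-subs≤innerSum fs k i k≤ = ≤-trans
    (∑-subs≤boxSum (range-unique k i) fs (λ x → 𝟙 (x ℕ.≟ i)) (All.map (λ {x} → cond {x}) k≤))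
    (≤-reflexive (sym (innerSum≡boxSum (pattern' fs) k i)))
    where
      cond : ∀ {x : Factor} → k ≤ proj₁ x →
        proj₁ x ∈ range k i ⊎ (proj₁ x ∉ range k i × (∀ y → proj₁ x ≤ y → 𝟙 (y ℕ.≟ i) ≡ 0))
      cond {n , _} k≤n with n ≤? i
      ... | yes n≤i = inj₁ (∈-range⁺ k≤n n≤i)
      ... | no n≰i  = inj₂ ((λ n∈ → n≰i (∈-range⇒≤ n∈)) , λ y n≤y → 𝟙-false (y ℕ.≟ i) λ { refl → n≰i n≤y })

  ∈⇒∣prodFactors : ∀ {n h} fs → (n , h) ∈ fs → monic h ∣ prodFactors fs
  ∈⇒∣prodFactors {h = h} (_ ∷ fs)       (here refl) = ∣-*ʳ (prodFactors fs) ∣-refl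
  ∈⇒∣prodFactors         ((_ , h′) ∷ fs) (there x∈) = ∣-*ˡ (monic h′) (∈⇒∣prodFactors fs x∈)

  degreeSum-map : ∀ {k} (Ps : List (Vec Carrier k)) → degreeSum (map (k ,_) Ps) ≡ length Ps * k
  degreeSum-map []       = refl
  degreeSum-map {k} (P ∷ Ps) = cong (k +_) (degreeSum-map Ps)

  -- Bounds for the sum of deg gcd(g, f) over all monic f of degree d.

  module Bounds {e d : ℕ} (g : Vec Carrier e) (fs : List Factor) (factorization : IsFactorization g fs)
    (k : ℕ) (0<λₖ : 0 < pattern' fs k) (λ<k : ∀ j → j < k → pattern' fs j ≡ 0) (k≤d : k ≤ d)
    (X : Vec Carrier d → ℕ) (X-gcd : ∀ f → IsDegGcd g f (X f)) where

    irreducible : AllIrreducible fs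
    irreducible = proj₁ factorization

    prod≋g : prodFactors fs ≋ monic g
    prod≋g = mk≋ (proj₂ factorization)

    Ps : List (Vec Carrier k)
    Ps = deduplicate _≟ᵛ_ (ofDeg k fs)

    ∈Ps⇒∈fs : ∀ {P} → P ∈ Ps → (k , P) ∈ fs
    ∈Ps⇒∈fs P∈ = ∈-ofDeg⁻ fs (∈-deduplicate⁻ _≟ᵛ_ (ofDeg k fs) P∈)

    0<length⇒∈ : ∀ {A : Set} (xs : List A) → 0 < length xs → ∃ λ x → x ∈ xs
    0<length⇒∈ (x ∷ xs) _ = x , here refl

    0<k : 0 < k
    0<k = let _ , P∈ = 0<length⇒∈ (ofDeg k fs) 0<λₖ in proj₁ (All.lookup irreducible (∈-ofDeg⁻ fs P∈))

    k≤degrees : All (λ x → k ≤ proj₁ x) fs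
    k≤degrees = All.tabulate λ {x} x∈ → ≮⇒≥ λ n<k →
      empty (∈-ofDeg⁺ fs x∈) (λ<k _ n<k)
      where
        empty : ∀ {A : Set} {x : A} {xs} → x ∈ xs → length xs ≡ 0 → ⊥
        empty (here _) ()
        empty (there _) ()

    -- The product of those `Ps` that divide f is a common divisor of g and f, and X f is the
    -- largest degree of such a divisor.
    X-lower : ∀ f → k * ∑ Ps (λ P → multiples k (monic P) f) ≤ X f
    X-lower f = begin
      k * ∑ Ps (λ P → multiples k (monic P) f) ≤⟨ *-monoʳ-≤ k (∑-mono Ps ind) ⟩
      k * ∑ Ps (λ P → 𝟙 (P? P))                ≡⟨ cong (k *_) (length-filter≡∑ P? Ps) ⟨
      k * length Qs                            ≡⟨ *-comm k (length Qs) ⟩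
      length Qs * k                            ≡⟨ degreeSum-map Qs ⟨
      degreeSum (map (k ,_) Qs)                ≤⟨ proj₂ (X-gcd f) _ (toVec (degreeSum (map (k ,_) Qs)) w) (w∣ w∣g) (w∣ w∣f) ⟩
      X f                                      ∎
      where
        open ≤-Reasoning
        -- A decidable form of "P divides f", as `multiples` takes only the values 0 and 1 here.
        P? = λ P → 1 ≤? multiples k (monic P) f
        Qs = filter P? Ps
        w = prodFactors (map (k ,_) Qs)
        ind : ∀ P → multiples k (monic P) f ≤ 𝟙 (P? P)
        ind P with P? P
        ... | yes _ = multiples≤1 (monic-isMonic P) f k≤d
        ... | no ¬p = ≤-reflexive (n<1⇒n≡0 (≰⇒> ¬p))
        Qs-unique : Unique Qs
        Qs-unique = Unique.filter⁺ P? (UniqueDec.deduplicate-! _≟ᵛ_ (ofDeg k fs))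
        Qs-from : ∀ {R : Vec Carrier k → Set} → (∀ {P} → (k , P) ∈ fs → R P) → All R Qs
        Qs-from r = All.filter⁺ P? (All.tabulate (r ∘ ∈Ps⇒∈fs))
        w∣f : w ∣ monic f
        w∣f = distinct-irreducibles-∣ Qs Qs-unique (Qs-from (All.lookup irreducible))
          (All.map (λ {P} → multiples>0⇒∣ (monic-isMonic P) f k≤d) (All.all-filter P? Ps))
        w∣g : w ∣ monic g
        w∣g = distinct-irreducibles-∣ Qs Qs-unique (Qs-from (All.lookup irreducible))
          (Qs-from (∣-respʳ prod≋g ∘ ∈⇒∣prodFactors fs))
        w∣ : ∀ {r} → w ∣ r → monic (toVec (degreeSum (map (k ,_) Qs)) w) ∣ₚ r
        w∣ w∣r = let divides s e = ∣-respˡ (≋-sym (monic-toVec (prodFactors-isMonic (map (k ,_) Qs)))) w∣r in s , coeff≡ e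

    ∑-multiples-Ps : ∑ (allMonic d) (λ f → k * ∑ Ps (λ P → multiples k (monic P) f)) ≡ (k * length Ps) * q ^ (d ∸ k)
    ∑-multiples-Ps = begin
      ∑ (allMonic d) (λ f → k * ∑ Ps (λ P → multiples k (monic P) f))
        ≡⟨ ∑-*ˡ (allMonic d) k _ ⟩
      k * ∑ (allMonic d) (λ f → ∑ Ps (λ P → multiples k (monic P) f))
        ≡⟨ cong (k *_) (∑-swap (allMonic d) Ps _) ⟩
      k * ∑ Ps (λ P → ∑ (allMonic d) (multiples k (monic P)))
        ≡⟨ cong (k *_) (∑-cong Ps (λ P → ∑-multiples d k (monic P))) ⟩
      k * ∑ Ps (λ P → q ^ (d ∸ k))
        ≡⟨ cong (k *_) (∑-const Ps (q ^ (d ∸ k))) ⟩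
      k * (length Ps * q ^ (d ∸ k))
        ≡⟨ *-assoc k (length Ps) _ ⟨
      (k * length Ps) * q ^ (d ∸ k) ∎
      where open ≡-Reasoning

    ∑X-lower : (k * length Ps) * q ^ (d ∸ k) ≤ ∑ (allMonic d) X
    ∑X-lower = subst (_≤ ∑ (allMonic d) X) ∑-multiples-Ps (∑-mono (allMonic d) X-lower)

    -- Two factors already have total degree at least 2k, which exceeds k because k is positive.
    degreeSum-shape : ∀ {S} → All (λ x → k ≤ proj₁ x) S →
      degreeSum S ≡ 0 ⊎ (∃ λ P → S ≡ (k , P) ∷ []) ⊎ k < degreeSum S
    degreeSum-shape {[]} _ = inj₁ refl
    degreeSum-shape {(n , P) ∷ []} (k≤n ∷ []) with m≤n⇒m<n∨m≡n k≤n
    ... | inj₁ k<n  = inj₂ (inj₂ (≤-trans k<n (m≤m+n n 0)))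
    ... | inj₂ refl = inj₂ (inj₁ (P , refl))
    degreeSum-shape {(n , _) ∷ (m , _) ∷ S} (k≤n ∷ k≤m ∷ _) =
      inj₂ (inj₂ (≤-trans (m<m+n k 0<k) (+-mono-≤ k≤n (≤-trans k≤m (m≤m+n m (degreeSum S))))))

    -- For i ≤ d, the number of sublists of total degree i whose product divides f. Sublists with
    -- the same product are counted separately, so this can exceed the number of divisors.
    divisors : ℕ → Vec Carrier d → ℕ
    divisors i f = ∑ (subs fs) (λ S → 𝟙 (degreeSum S ℕ.≟ i) * multiples i (prodFactors S) f)

    -- The gcd is the product of some sublist S, and X f is its total degree. In each case of
    -- `degreeSum-shape` a single term of the right side, or none, already accounts for X f.
    X-upper : ∀ f → X f ≤ k * ∑ Ps (λ P → multiples k (monic P) f) + ∑ (range (suc k) d) (λ i → i * divisors i f)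
    X-upper f with X-gcd f
    ... | (h , (s , hs≈g) , (t , ht≈f)) , _
        with divisor-is-subproduct fs irreducible (monic-isMonic h)
               (∣-respʳ (≋-sym prod≋g) (divides s (mk≋ hs≈g)))
    ...   | S , S∈ , h≋S with degreeSum-shape (subs-All fs k≤degrees S∈)
                            | IsMonic-unique (prodFactors-isMonic S) (IsMonic-resp-≋ h≋S (monic-isMonic h))
    ...     | inj₁ deg≡0 | deg≡X = subst (_≤ _) (trans (sym deg≡0) deg≡X) z≤n
    ...     | inj₂ (inj₁ (P , refl)) | deg≡X = begin
      X f                                          ≡⟨ trans (sym deg≡X) (+-identityʳ k) ⟩
      k                                            ≡⟨ *-identityʳ k ⟨
      k * 1                                        ≤⟨ *-monoʳ-≤ k (≤-trans (∣⇒multiples≥1 (monic-isMonic P) f P∣f) (∑-∈ (λ Q → multiples k (monic Q) f) P∈Ps)) ⟩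
      k * ∑ Ps (λ P → multiples k (monic P) f)     ≤⟨ m≤m+n _ _ ⟩
      k * ∑ Ps (λ P → multiples k (monic P) f) + ∑ (range (suc k) d) (λ i → i * divisors i f) ∎
      where
        open ≤-Reasoning
        P∣f : monic P ∣ monic f
        P∣f = ∣-respˡ (≋-trans h≋S (*ₚ-identityʳ (monic P))) (divides t (mk≋ ht≈f))
        P∈Ps : P ∈ Ps
        -- `subs-All` for the predicate of membership in `fs` shows that the entries of S are
        -- factors of g.
        P∈Ps = ∈-deduplicate⁺ _≟ᵛ_ (∈-ofDeg⁺ fs (All.lookup (subs-All fs (All.tabulate (λ x∈ → x∈)) S∈) (here refl)))
    -- The relevant term is the one at i = X f, which lies in the range since k < X f ≤ d.
    ...     | inj₂ (inj₂ k<deg) | deg≡X = begin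
      X f                                                ≡⟨ *-identityʳ (X f) ⟨
      X f * 1                                            ≤⟨ *-monoʳ-≤ (X f) one≤ ⟩
      X f * divisors (X f) f                             ≤⟨ ∑-∈ (λ i → i * divisors i f) (∈-range⁺ (subst (k <_) deg≡X k<deg) X≤d) ⟩
      ∑ (range (suc k) d) (λ i → i * divisors i f)       ≤⟨ m≤n+m _ _ ⟩
      k * ∑ Ps (λ P → multiples k (monic P) f) + ∑ (range (suc k) d) (λ i → i * divisors i f) ∎
      where
        open ≤-Reasoning
        h∣f : monic h ∣ monic f
        h∣f = divides t (mk≋ ht≈f)
        X≤d : X f ≤ d
        X≤d with quotient-monic (monic-isMonic h) (monic-isMonic f) (mk≋ ht≈f)
        ... | l , X+l≡d , _ = m+n≤o⇒m≤o (X f) (≤-reflexive X+l≡d)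
        one≤ : 1 ≤ divisors (X f) f
        one≤ = begin
          1                                                                  ≤⟨ ∣⇒multiples≥1 (subst (λ i → IsMonic i (prodFactors S)) deg≡X (prodFactors-isMonic S)) f (∣-respˡ h≋S h∣f) ⟩
          multiples (X f) (prodFactors S) f                                  ≡⟨ *-identityˡ _ ⟨
          1 * multiples (X f) (prodFactors S) f                              ≡⟨ cong (_* multiples (X f) (prodFactors S) f) (𝟙-true (degreeSum S ℕ.≟ X f) deg≡X) ⟨
          𝟙 (degreeSum S ℕ.≟ X f) * multiples (X f) (prodFactors S) f        ≤⟨ ∑-∈ (λ S → 𝟙 (degreeSum S ℕ.≟ X f) * multiples (X f) (prodFactors S) f) S∈ ⟩
          divisors (X f) f                                                   ∎

    ∑-divisors : ∀ i → ∑ (allMonic d) (divisors i) ≤ innerSum (pattern' fs) k i * q ^ (d ∸ i)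
    ∑-divisors i = begin
      ∑ (allMonic d) (divisors i)
        ≡⟨ ∑-swap (allMonic d) (subs fs) _ ⟩
      ∑ (subs fs) (λ S → ∑ (allMonic d) (λ f → 𝟙 (degreeSum S ℕ.≟ i) * multiples i (prodFactors S) f))
        ≡⟨ ∑-cong (subs fs) (λ S → trans (∑-*ˡ (allMonic d) (𝟙 (degreeSum S ℕ.≟ i)) _)
             (cong (𝟙 (degreeSum S ℕ.≟ i) *_) (∑-multiples d i (prodFactors S)))) ⟩
      ∑ (subs fs) (λ S → 𝟙 (degreeSum S ℕ.≟ i) * q ^ (d ∸ i))
        ≡⟨ ∑-*ʳ (subs fs) _ (q ^ (d ∸ i)) ⟩
      ∑ (subs fs) (λ S → 𝟙 (degreeSum S ℕ.≟ i)) * q ^ (d ∸ i)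
        ≤⟨ *-monoˡ-≤ (q ^ (d ∸ i)) (∑-subs≤innerSum fs k i k≤degrees) ⟩
      innerSum (pattern' fs) k i * q ^ (d ∸ i) ∎
      where open ≤-Reasoning

    ∑X-upper : ∑ (allMonic d) X ≤
      (k * length Ps) * q ^ (d ∸ k) + ∑ (range (suc k) d) (λ i → (i * innerSum (pattern' fs) k i) * q ^ (d ∸ i))
    ∑X-upper = begin
      ∑ (allMonic d) X
        ≤⟨ ∑-mono (allMonic d) X-upper ⟩
      ∑ (allMonic d) (λ f → k * ∑ Ps (λ P → multiples k (monic P) f) + ∑ (range (suc k) d) (λ i → i * divisors i f))
        ≡⟨ ∑-+ (allMonic d) (λ f → k * ∑ Ps (λ P → multiples k (monic P) f)) _ ⟩
      ∑ (allMonic d) (λ f → k * ∑ Ps (λ P → multiples k (monic P) f)) + ∑ (allMonic d) (λ f → ∑ (range (suc k) d) (λ i → i * divisors i f))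
        ≡⟨ cong₂ _+_ ∑-multiples-Ps (∑-swap (allMonic d) (range (suc k) d) _) ⟩
      (k * length Ps) * q ^ (d ∸ k) + ∑ (range (suc k) d) (λ i → ∑ (allMonic d) (λ f → i * divisors i f))
        ≤⟨ +-monoʳ-≤ ((k * length Ps) * q ^ (d ∸ k)) (∑-mono (range (suc k) d) term) ⟩
      (k * length Ps) * q ^ (d ∸ k) + ∑ (range (suc k) d) (λ i → (i * innerSum (pattern' fs) k i) * q ^ (d ∸ i)) ∎
      where
        open ≤-Reasoning
        term : ∀ i → ∑ (allMonic d) (λ f → i * divisors i f) ≤ (i * innerSum (pattern' fs) k i) * q ^ (d ∸ i)
        term i = begin
          ∑ (allMonic d) (λ f → i * divisors i f)           ≡⟨ ∑-*ˡ (allMonic d) i (divisors i) ⟩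
          i * ∑ (allMonic d) (divisors i)                   ≤⟨ *-monoʳ-≤ i (∑-divisors i) ⟩
          i * (innerSum (pattern' fs) k i * q ^ (d ∸ i))    ≡⟨ *-assoc i _ _ ⟨
          (i * innerSum (pattern' fs) k i) * q ^ (d ∸ i)    ∎

open import Data.Integer as ℤ using (+_)
import Data.Integer.Properties as ℤ
open import Data.Integer.Tactic.RingSolver using () renaming (solve-∀ to solve-∀ℤ)
open import Data.Rational using (ℚ; 0ℚ; toℚᵘ) renaming (_≤_ to _≤ℚ_; _+_ to _+ℚ_; _-_ to _-ℚ_)
import Data.Rational.Properties as ℚ
open import Data.Rational.Unnormalised as ℚᵘ using (mkℚᵘ; *≡*; *≤*)
import Data.Rational.Unnormalised.Properties as ℚᵘ

-- Fractions of natural numbers, and the passage from sums to expected values.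

÷-mono-≤ : ∀ {a b} n → a ≤ b → (a ÷ n) ≤ℚ (b ÷ n)
-- With denominator 0 both fractions take the default value `0ℚ`.
÷-mono-≤ zero    _ = ℚ.≤-refl
÷-mono-≤ {a} {b} (suc n) a≤b = ℚ.toℚᵘ-cancel-≤ (begin
  toℚᵘ (a ÷ suc n)  ≃⟨ ℚ.toℚᵘ-fromℚᵘ (mkℚᵘ (+ a) n) ⟩
  mkℚᵘ (+ a) n      ≤⟨ *≤* (ℤ.*-monoʳ-≤-nonNeg (+ suc n) (ℤ.+≤+ a≤b)) ⟩
  mkℚᵘ (+ b) n      ≃⟨ ℚ.toℚᵘ-fromℚᵘ (mkℚᵘ (+ b) n) ⟨
  toℚᵘ (b ÷ suc n)  ∎)
  where open ℚᵘ.≤-Reasoning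

0÷n≡0 : ∀ n → 0 ÷ n ≡ 0ℚ
0÷n≡0 zero    = refl
0÷n≡0 (suc n) = ℚ.fromℚᵘ-cong {mkℚᵘ (+ 0) n} {mkℚᵘ (+ 0) 0} (*≡* refl)

÷-nonneg : ∀ a n → 0ℚ ≤ℚ (a ÷ n)
÷-nonneg a n = subst (_≤ℚ (a ÷ n)) (0÷n≡0 n) (÷-mono-≤ n z≤n)

÷-cong : ∀ a {b} c {d} .{{_ : NonZero b}} .{{_ : NonZero d}} → a * d ≡ c * b → a ÷ b ≡ c ÷ d
÷-cong a {suc b} c {suc d} e = ℚ.fromℚᵘ-cong {mkℚᵘ (+ a) b} {mkℚᵘ (+ c) d}
  (*≡* (trans (sym (ℤ.pos-* a (suc d))) (trans (cong +_ e) (ℤ.pos-* c (suc b)))))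

÷-distrib-+ : ∀ a b n → (a ÷ n) +ℚ (b ÷ n) ≡ (a + b) ÷ n
÷-distrib-+ a b zero    = refl
÷-distrib-+ a b (suc n) = ℚ.toℚᵘ-injective (begin
  toℚᵘ ((a ÷ suc n) +ℚ (b ÷ suc n))
    ≈⟨ ℚ.toℚᵘ-homo-+ (a ÷ suc n) (b ÷ suc n) ⟩
  toℚᵘ (a ÷ suc n) ℚᵘ.+ toℚᵘ (b ÷ suc n)
    ≈⟨ ℚᵘ.+-cong (ℚ.toℚᵘ-fromℚᵘ (mkℚᵘ (+ a) n)) (ℚ.toℚᵘ-fromℚᵘ (mkℚᵘ (+ b) n)) ⟩
  mkℚᵘ (+ a) n ℚᵘ.+ mkℚᵘ (+ b) n
    ≈⟨ *≡* (trans (lemma (+ a) (+ b) (+ suc n)) (cong₂ ℤ._*_ (sym (ℤ.pos-+ a b)) (sym (ℤ.pos-* (suc n) (suc n))))) ⟩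
  mkℚᵘ (+ (a + b)) n
    ≈⟨ ℚ.toℚᵘ-fromℚᵘ (mkℚᵘ (+ (a + b)) n) ⟨
  toℚᵘ ((a + b) ÷ suc n) ∎)
  where
    open SetoidReasoning ℚᵘ.≃-setoid
    lemma : ∀ x y z → (x ℤ.* z ℤ.+ y ℤ.* z) ℤ.* z ≡ (x ℤ.+ y) ℤ.* (z ℤ.* z)
    lemma = solve-∀ℤ

-- Brings the terms of both bounds to the denominator q^d of the expected value, so that they can be
-- compared with the counts over all f.
÷-extend : ∀ a q {i d} .{{_ : NonZero q}} → i ≤ d → a ÷ (q ^ i) ≡ (a * q ^ (d ∸ i)) ÷ (q ^ d)
÷-extend a q {i} {d} i≤d = ÷-cong a (a * q ^ (d ∸ i)) {{m^n≢0 q i}} {{m^n≢0 q d}} (begin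
  a * q ^ d                  ≡⟨ cong (λ n → a * q ^ n) (m∸n+n≡m i≤d) ⟨
  a * q ^ (d ∸ i + i)        ≡⟨ cong (a *_) (^-distribˡ-+-* q (d ∸ i) i) ⟩
  a * (q ^ (d ∸ i) * q ^ i)  ≡⟨ *-assoc a _ _ ⟨
  a * q ^ (d ∸ i) * q ^ i    ∎)
  where open ≡-Reasoning

sumℚ-÷ : ∀ q {d} .{{_ : NonZero q}} (a : ℕ → ℕ) is → (∀ {i} → i ∈ is → i ≤ d) →
  sumℚ (map (λ i → a i ÷ (q ^ i)) is) ≡ ∑ is (λ i → a i * q ^ (d ∸ i)) ÷ (q ^ d)
sumℚ-÷ q {d} a []       _  = sym (0÷n≡0 (q ^ d))
sumℚ-÷ q {d} a (i ∷ is) ≤d = trans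
  (cong₂ _+ℚ_ (÷-extend (a i) q (≤d (here refl))) (sumℚ-÷ q a is (≤d ∘ there)))
  (÷-distrib-+ (a i * q ^ (d ∸ i)) _ (q ^ d))

-- The enumeration assigns an index in `Fin q` to `0#`, so `Fin q` is inhabited.
field-size≢0 : ∀ {q} → FiniteField q → NonZero q
field-size≢0 {zero} F with Inverse.from (FiniteField.enum F) (FiniteField.0# F)
... | ()
field-size≢0 {suc q} F = _

p-q≤p : ∀ p {r} → 0ℚ ≤ℚ r → p -ℚ r ≤ℚ p
p-q≤p p {r} 0≤r = subst (p -ℚ r ≤ℚ_) (ℚ.+-identityʳ p) (ℚ.+-monoʳ-≤ p (ℚ.neg-antimono-≤ 0≤r))

theorem4p5 :
    (q : ℕ) → IsPrimePower q → (F : FiniteField q) →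
    (e d : ℕ) → d < e → 0 < d →
    (g : Vec (FiniteField.Carrier F) e) →
    (fs : List (FiniteField.Factor F)) → FiniteField.IsFactorization F g fs →
    (k : ℕ) → 0 < FiniteField.pattern' F fs k →
    (∀ j → j < k → FiniteField.pattern' F fs j ≡ 0) →
    k ≤ d →
    (X : Vec (FiniteField.Carrier F) d → ℕ) →
    (∀ f → FiniteField.IsDegGcd F g f (X f)) →
    let lam = FiniteField.pattern' F fs
        lamStar = FiniteField.distinctOfDeg F fs k
        EX = sum (map X (FiniteField.allMonic F d)) ÷ (q ^ d)
    in (((k * lamStar) ÷ (q ^ k)) -ℚ (((lamStar C 2) * k) ÷ (q ^ ((2 * k) ⊓ d))) ≤ℚ EX)
       × (EX ≤ℚ (((k * lamStar) ÷ (q ^ k))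
                  +ℚ sumℚ (map (λ i → (i * innerSum lam k i) ÷ (q ^ i)) (range (ℕ.suc k) d))))
theorem4p5 q _ F e d _ _ g fs factorization k 0<λₖ λ<k k≤d X X-gcd = lower , upper
  where
    open FiniteField F using (pattern'; distinctOfDeg; allMonic)
    open Counting.Bounds F g fs factorization k 0<λₖ λ<k k≤d X X-gcd
    open ℚ.≤-Reasoning
    instance
      q≢0 : NonZero q
      q≢0 = field-size≢0 F
    λ* = distinctOfDeg fs k
    EX = sum (map X (allMonic d)) ÷ (q ^ d)
    is = range (suc k) d
    c = λ i → i * innerSum (pattern' fs) k i

    lower : ((k * λ*) ÷ (q ^ k)) -ℚ (((λ* C 2) * k) ÷ (q ^ ((2 * k) ⊓ d))) ≤ℚ EX
    lower = begin
      ((k * λ*) ÷ (q ^ k)) -ℚ (((λ* C 2) * k) ÷ (q ^ ((2 * k) ⊓ d)))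
        ≤⟨ p-q≤p ((k * λ*) ÷ (q ^ k)) (÷-nonneg ((λ* C 2) * k) (q ^ ((2 * k) ⊓ d))) ⟩
      (k * λ*) ÷ (q ^ k)
        ≡⟨ ÷-extend (k * λ*) q k≤d ⟩
      (k * λ* * q ^ (d ∸ k)) ÷ (q ^ d)
        ≤⟨ ÷-mono-≤ (q ^ d) ∑X-lower ⟩
      EX ∎

    upper : EX ≤ℚ (((k * λ*) ÷ (q ^ k)) +ℚ sumℚ (map (λ i → c i ÷ (q ^ i)) is))
    upper = begin
      EX
        ≤⟨ ÷-mono-≤ (q ^ d) ∑X-upper ⟩
      (k * λ* * q ^ (d ∸ k) + ∑ is (λ i → c i * q ^ (d ∸ i))) ÷ (q ^ d)
        ≡⟨ ÷-distrib-+ (k * λ* * q ^ (d ∸ k)) _ (q ^ d) ⟨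
      ((k * λ* * q ^ (d ∸ k)) ÷ (q ^ d)) +ℚ (∑ is (λ i → c i * q ^ (d ∸ i)) ÷ (q ^ d))
        ≡⟨ cong₂ _+ℚ_ (÷-extend (k * λ*) q k≤d) (sumℚ-÷ q c is ∈-range⇒≤) ⟨
      ((k * λ*) ÷ (q ^ k)) +ℚ sumℚ (map (λ i → c i ÷ (q ^ i)) is) ∎
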